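{- Let $N$ be an odd positive integer such that $\sigma^*(\sigma^*(N))=2N$. Then $N=9$ or $N=165$.
   Context: For a positive integer $n$, a divisor $d$ of $n$ is called a unitary divisor if $\gcd(d,n/d)=1$, and $\sigma^*(n)$ denotes the sum of all unitary divisors of $n$. An integer $N$ with $\sigma^*(\sigma^*(N))=2N$ is called a unitary super perfect (USP) number. -}

module Defs where

open import Data.Nat using (ℕ; zero; suc; _≟_)
open import Data.Nat.Divisibility using (_∣_; _∣?_)
open import Data.Nat.DivMod using (_/_)
open import Data.Nat.GCD using (gcd)
open import Data.List using (List; map; filter; upTo)
open import Data.Nat.ListAction using (sum)
open import Data.Product using (_×_)
open import Relation.Nullary using (Dec)
open import Relation.Nullary.Decidable using (_×-dec_)
open import Relation.Binary.PropositionalEquality using (_≡_)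

IsUnitaryDivisorSuc : ℕ → ℕ → Set
IsUnitaryDivisorSuc n k = (suc k ∣ n) × (gcd (suc k) (n / suc k) ≡ 1)

isUnitaryDivisorSuc? : ∀ n k → Dec (IsUnitaryDivisorSuc n k)
isUnitaryDivisorSuc? n k = (suc k ∣? n) ×-dec (gcd (suc k) (n / suc k) ≟ 1)

unitaryDivisors : ℕ → List ℕ
unitaryDivisors n = map suc (filter (isUnitaryDivisorSuc? n) (upTo n))

σ* : ℕ → ℕ
σ* n = sum (unitaryDivisors n)

{-# OPTIONS --safe #-}
module Submission where

-- Multiplicativity forces σ*(N) = 2^f q^g with q an odd prime, so that
-- 2N = (2^f + 1)(q^g + 1) and every prime power P exactly dividing N has the form
-- 2^a q^b - 1, with (a , b) summing to (f , g). Since -1 is not a square modulo a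
-- divisor ≡ 3 (mod 4), nor -2 modulo one ≡ 7 (mod 8), and x² - 1 is an odd prime
-- power only for x = 2, the pair (a , b) is one of (1 , b), (2 , 0), (2 , odd) and,
-- for odd g only, (odd ≥ 3 , even). The product of P/(P + 1) over N is at least
-- 1 - Σ 1/(P + 1), a sum of geometric series, while it equals
-- (1 + 2^-f)(1 + q^-g)/2; with the component 3, and for q = 3 also 5 and 11,
-- split off and congruences modulo 3 and 9 taken into account, these contradict
-- each other unless N = 9 or N = 3 · 5 · 11.
open import Defs
open import Data.Empty using (⊥; ⊥-elim)
open import Data.List using (List; []; _∷_; _++_; map; upTo; applyUpTo; concat)
import Data.List.Membership.DecPropositional as DecMembership
open import Data.List.Membership.Propositional using (_∈_; _∉_)
open import Data.List.Membership.Propositional.Properties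
  using (∈-map⁺; ∈-map⁻; ∈-filter⁺; ∈-filter⁻; ∈-upTo⁺; ∈-++⁺ˡ; ∈-++⁺ʳ; ∈-++⁻;
         ∈-∃++; ∈-applyUpTo⁺; ∈-concat⁺′)
open import Data.List.Membership.Propositional.Properties.WithK using (unique∧set⇒bag)
open import Data.List.Properties using (map-++; map-applyUpTo)
open import Data.List.Relation.Binary.BagAndSetEquality using (∼bag⇒↭)
open import Data.List.Relation.Binary.Permutation.Propositional using (_↭_; ↭-sym; ↭⇒↭ₛ)
open import Data.List.Relation.Binary.Permutation.Propositional.Properties as Perm
  using (shift; ∈-resp-↭; All-resp-↭)
import Data.List.Relation.Binary.Permutation.Setoid.Properties as PermS
open import Data.List.Relation.Unary.All as All using (All; []; _∷_)
open import Data.List.Relation.Unary.AllPairs using (AllPairs; []; _∷_)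
open import Data.List.Relation.Unary.Any using (here; there)
open import Data.List.Relation.Unary.Unique.Propositional using (Unique)
import Data.List.Relation.Unary.Unique.Propositional.Properties as Uniqueₚ
open import Data.Nat
open import Data.Nat.Coprimality as Coprime
  using (Coprime; coprime⇒gcd≡1; gcd≡1⇒coprime; coprime-divisor)
open import Data.Nat.DivMod hiding (result)
open import Data.Nat.Divisibility
open import Data.Nat.GCD using (gcd)
open import Data.Nat.Induction using (<-rec)
open import Data.Nat.ListAction using (sum; product)
open import Data.Nat.ListAction.Properties using (sum-++; sum-↭; product-↭; ∈⇒∣product)
open import Data.Nat.Primality
open import Data.Nat.Primality.Factorisation using (factorise; PrimeFactorisation)
open import Data.Nat.Properties
open import Data.Nat.Tactic.RingSolver using (solve-∀)
open import Data.Product using (∃; ∃₂; _×_; _,_; proj₁; proj₂)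
open import Data.Product.Properties using (≡-dec)
open import Data.Sum using (_⊎_; inj₁; inj₂; [_,_]′)
open import Data.Unit using (tt)
open import Function using (_∘_; _$_; mk⇔)
open import Relation.Binary.Definitions using (tri<; tri≈; tri>)
open import Relation.Binary.PropositionalEquality
open import Relation.Nullary using (¬_; Dec; yes; no; contradiction)
open import Relation.Nullary.Decidable using (¬?; _×-dec_; _⊎-dec_; _→-dec_; from-yes)
open import Relation.Unary using (Decidable)

open DecMembership (≡-dec _≟_ _≟_) using (_∈?_)

-- The value (1 + 2^-f)(1 + q^-g)/2 always exceeds 1/2, so the linear bound 1 - Σ 1/(P + 1) can only
-- contradict it while the sum stays below 1/2. The components 3, 5 and 11 contribute 1/4 + 1/6 +
-- 1/12, which is already 1/2. They are therefore kept as an exact factor n₀/m₀, and the linear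
-- bound is applied only to what is left. For 3 · 5 · 11 itself both sides agree, 165/288 =
-- (33/32)(10/9)/2, so there everything turns on whether a further component exists.
--
-- The two nonresidue facts are proved by infinite descent in the style of Fermat, without Legendre
-- symbols; all that depends on the modulus is then a finite check of residues modulo 8.
--
-- The series are cut to finite lists and cleared of denominators. The resulting bounds are monotone
-- in f, g and q, so each case is tested once, at its least admissible values, as an inequality
-- between numerals.

-- Prime divisors and coprimality.

prime-divisor : ∀ {n} → 1 < n → ∃ λ p → Prime p × p ∣ n
prime-divisor {n} 1<n = go factors isFactorisation factorsPrime
  where
  open PrimeFactorisation (factorise n {{>-nonZero (<-trans z<s 1<n)}})
  go : ∀ ps → n ≡ product ps → All Prime ps → ∃ λ p → Prime p × p ∣ n
  go []       refl _        = contradiction 1<n (<-irrefl refl)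
  go (p ∷ ps) refl (pr ∷ _) = p , pr , m∣m*n (product ps)

prime>1 : ∀ {p} → Prime p → 1 < p
prime>1 pr = nonTrivial⇒n>1 _ {{prime⇒nonTrivial pr}}

prime∤1 : ∀ {p} → Prime p → p ∤ 1
prime∤1 pr p∣1 = <-irrefl (sym (∣1⇒≡1 p∣1)) (prime>1 pr)

prime∣prime : ∀ {p r} → Prime p → Prime r → p ∣ r → p ≡ r
prime∣prime pp pr p∣r with prime⇒irreducible pr p∣r
... | inj₁ refl = contradiction (∣-refl) (prime∤1 pp)
... | inj₂ eq = eq

prime∣^ : ∀ {p} n e → Prime p → p ∣ n ^ e → p ∣ n
prime∣^ n zero    pr p∣ = contradiction p∣ (prime∤1 pr)
prime∣^ n (suc e) pr p∣ with euclidsLemma n (n ^ e) pr p∣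
... | inj₁ h = h
... | inj₂ h = prime∣^ n e pr h

prime∤⇒coprime-^ : ∀ {p m} e → Prime p → p ∤ m → Coprime (p ^ e) m
prime∤⇒coprime-^ {p} {m} e pr p∤m {d} (d∣p^e , d∣m) with <-cmp d 1
... | tri≈ _ eq _ = eq
... | tri< (s≤s z≤n) _ _ =
      contradiction (subst (p ∣_) (sym (0∣⇒≡0 d∣m)) (p ∣0)) p∤m
... | tri> _ _ 1<d with r , rp , r∣d ← prime-divisor 1<d =
      contradiction (subst (_∣ m) (prime∣prime rp pr (prime∣^ p e rp (∣-trans r∣d d∣p^e))) (∣-trans r∣d d∣m)) p∤m

m^1+n>1 : ∀ {m} n → 1 < m → 1 < m ^ suc n
m^1+n>1 {m} n 1<m = <-≤-trans 1<m (m≤m*n m (m ^ n) {{m^n≢0 m n {{>-nonZero (<-trans z<s 1<m)}}}})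

extract-power : ∀ r n → 1 < r → 0 < n → ∃₂ λ e m → n ≡ r ^ e * m × r ∤ m × 0 < m
extract-power r n 1<r = <-rec (λ n → 0 < n → ∃₂ λ e m → n ≡ r ^ e * m × r ∤ m × 0 < m) step n
  where
  step : ∀ n → (∀ {k} → k < n → 0 < k → ∃₂ λ e m → k ≡ r ^ e * m × r ∤ m × 0 < m) →
         0 < n → ∃₂ λ e m → n ≡ r ^ e * m × r ∤ m × 0 < m
  step n rec 0<n with r ∣? n
  ... | no r∤n = 0 , n , sym (*-identityˡ n) , r∤n , 0<n
  ... | yes (divides zero refl) = contradiction 0<n λ ()
  ... | yes (divides k@(suc _) refl) with rec (m<m*n k r 1<r) z<s
  ...   | e , m , eq , r∤m , 0<m = suc e , m , trans (cong (_* r) eq) (lem r (r ^ e) m) , r∤m , 0<m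
    where
    lem : ∀ r x m → x * m * r ≡ r * x * m
    lem = solve-∀

extract-prime : ∀ {n} → 1 < n → ∃ λ p → ∃₂ λ e m → Prime p × n ≡ p ^ suc e * m × p ∤ m × 0 < m × m < n
extract-prime {n} 1<n with p , pr , p∣n ← prime-divisor 1<n
  with extract-power p n (prime>1 pr) (<-trans z<s 1<n)
... | zero  , m , eq , p∤m , _ = contradiction (subst (p ∣_) (trans eq (*-identityˡ m)) p∣n) p∤m
... | suc e , m , refl , p∤m , 0<m = p , e , m , pr , refl , p∤m , 0<m ,
  subst (m <_) (*-comm m _) (m<m*n m _ {{>-nonZero 0<m}} (m^1+n>1 e (prime>1 pr)))

-- Unitary divisors and the multiplicativity of `σ*`.

∈-unitaryDivisors⁺ : ∀ {n} d c → 0 < n → d * c ≡ n → Coprime d c → d ∈ unitaryDivisors n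
∈-unitaryDivisors⁺ zero c 0<n refl _ = contradiction 0<n λ ()
∈-unitaryDivisors⁺ {n} (suc k) c 0<n eq cop =
  ∈-map⁺ suc (∈-filter⁺ (isUnitaryDivisorSuc? n)
    (∈-upTo⁺ (∣⇒≤ {{>-nonZero 0<n}} d∣n))
    (d∣n , trans (cong (gcd (suc k)) (n/m≡quotient d∣n)) (coprime⇒gcd≡1 cop)))
  where
  d∣n : suc k ∣ n
  d∣n = divides c (trans (sym eq) (*-comm (suc k) c))

∈-unitaryDivisors⁻ : ∀ {n d} → d ∈ unitaryDivisors n → ∃ λ c → d * c ≡ n × Coprime d c
∈-unitaryDivisors⁻ {n} d∈ with k , k∈ , refl ← ∈-map⁻ suc d∈
  with _ , d∣n , gcd≡1 ← ∈-filter⁻ (isUnitaryDivisorSuc? n) {xs = upTo n} k∈ =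
  quotient d∣n , sym (m∣n⇒n≡m*quotient d∣n) ,
  gcd≡1⇒coprime (trans (cong (gcd (suc k)) (sym (n/m≡quotient d∣n))) gcd≡1)

unitaryDivisors-unique : ∀ n → Unique (unitaryDivisors n)
unitaryDivisors-unique n = Uniqueₚ.map⁺ suc-injective (Uniqueₚ.filter⁺ (isUnitaryDivisorSuc? n) (Uniqueₚ.upTo⁺ n))

coprime-* : ∀ {a b c} → Coprime a c → Coprime b c → Coprime (a * b) c
coprime-* {a} {b} {c} ac bc {d} (d∣ab , d∣c) =
  bc (coprime-divisor (λ (x , y) → ac (y , ∣-trans x d∣c)) d∣ab , d∣c)

coprime-∣ : ∀ {a b c d} → Coprime a b → c ∣ a → d ∣ b → Coprime c d
coprime-∣ ab ca db (x , y) = ab (∣-trans x ca , ∣-trans y db)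

module _ {p : ℕ} (pr : Prime p) (e : ℕ) {m : ℕ} (0<m : 0 < m) (p∤m : p ∤ m) where
  private
    P = p ^ suc e

    instance
      _ = prime⇒nonZero pr
      _ = m^n≢0 p (suc e)
      _ = >-nonZero 0<m

    P-coprime : ∀ {c} → p ∤ c → Coprime P c
    P-coprime = prime∤⇒coprime-^ (suc e) pr

    lem : ∀ x y z → x * y * z ≡ y * (x * z)
    lem = solve-∀

    shape : ∀ {d c} → d * c ≡ P * m → Coprime d c → p ∤ d → ∃ λ c′ → d * c′ ≡ m × c ≡ P * c′
    shape {d} {c} eq cop p∤d with coprime-divisor (Coprime.sym (P-coprime p∤d)) (subst (d ∣_) eq (m∣m*n c))
    ... | divides k refl = k , *-comm d k , *-cancelˡ-≡ c (P * k) d {{m*n≢0⇒n≢0 k}}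
                             (trans eq (trans (sym (*-assoc P k d)) (*-comm (P * k) d)))

    to : ∀ {d} → d ∈ unitaryDivisors (P * m) → d ∈ unitaryDivisors m ++ map (P *_) (unitaryDivisors m)
    to {d} d∈ with c , eq , cop ← ∈-unitaryDivisors⁻ d∈ with p ∣? d
    ... | no p∤d with k , eq′ , c≡ ← shape {d} {c} eq cop p∤d =
      ∈-++⁺ˡ (∈-unitaryDivisors⁺ d k 0<m eq′ (coprime-∣ cop ∣-refl (divides P c≡)))
    ... | yes p∣d with k , eq′ , refl ← shape {c} {d} (trans (*-comm c d) eq) (Coprime.sym cop)
                          (λ p∣c → prime∤1 pr (subst (p ∣_) (cop (p∣d , p∣c)) ∣-refl)) =
      ∈-++⁺ʳ (unitaryDivisors m) (∈-map⁺ (P *_) (∈-unitaryDivisors⁺ k c 0<m (trans (*-comm k c) eq′)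
        (coprime-∣ cop (n∣m*n P) ∣-refl)))

    from : ∀ {d} → d ∈ unitaryDivisors m ++ map (P *_) (unitaryDivisors m) → d ∈ unitaryDivisors (P * m)
    from {d} d∈ with ∈-++⁻ (unitaryDivisors m) d∈
    ... | inj₁ d∈′ with c , eq , cop ← ∈-unitaryDivisors⁻ d∈′ =
      ∈-unitaryDivisors⁺ d (P * c) (>-nonZero⁻¹ (P * m) {{m*n≢0 P m}})
        (trans (sym (lem P d c) ) (trans (*-assoc P d c) (cong (P *_) eq)))
        (Coprime.sym (coprime-* (P-coprime (λ p∣d → p∤m (∣-trans p∣d (divides c (trans (sym eq) (*-comm d c)))))) (Coprime.sym cop)))
    ... | inj₂ d∈′ with k , k∈ , refl ← ∈-map⁻ (P *_) d∈′ with c , eq , cop ← ∈-unitaryDivisors⁻ k∈ =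
      ∈-unitaryDivisors⁺ (P * k) c (>-nonZero⁻¹ (P * m) {{m*n≢0 P m}})
        (trans (*-assoc P k c) (cong (P *_) eq))
        (coprime-* (P-coprime (λ p∣c → p∤m (∣-trans p∣c (divides k (sym eq))))) cop)

    unique : Unique (unitaryDivisors m ++ map (P *_) (unitaryDivisors m))
    unique = Uniqueₚ.++⁺ (unitaryDivisors-unique m)
      (Uniqueₚ.map⁺ (*-cancelˡ-≡ _ _ P) (unitaryDivisors-unique m))
      disjoint
      where
      disjoint : ∀ {d} → ¬ (d ∈ unitaryDivisors m × d ∈ map (P *_) (unitaryDivisors m))
      disjoint {d} (d∈ , d∈′) with c , eq , _ ← ∈-unitaryDivisors⁻ {m} d∈ with k , _ , refl ← ∈-map⁻ (P *_) d∈′ =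
        p∤m (subst (p ∣_) eq (∣m⇒∣m*n c (∣m⇒∣m*n k (m∣m*n (p ^ e)))))

    sum-map-* : ∀ xs → sum (map (P *_) xs) ≡ P * sum xs
    sum-map-* []       = sym (*-zeroʳ P)
    sum-map-* (x ∷ xs) = trans (cong (P * x +_) (sum-map-* xs)) (sym (*-distribˡ-+ P x (sum xs)))

  -- In a unitary divisor of `P * m` the prime p occurs not at all or to its full power. So the
  -- divisors are those of m together with their multiples by `P`, without overlap.
  σ*-prime-power-* : σ* (P * m) ≡ (P + 1) * σ* m
  σ*-prime-power-* = begin
    σ* (P * m)                                                       ≡⟨ sum-↭ (∼bag⇒↭ (unique∧set⇒bag (unitaryDivisors-unique (P * m)) unique (mk⇔ to from))) ⟩
    sum (unitaryDivisors m ++ map (P *_) (unitaryDivisors m))        ≡⟨ sum-++ (unitaryDivisors m) _ ⟩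
    σ* m + sum (map (P *_) (unitaryDivisors m))                      ≡⟨ cong (σ* m +_) (sum-map-* (unitaryDivisors m)) ⟩
    σ* m + P * σ* m                                                  ≡⟨ dist (σ* m) P ⟩
    (P + 1) * σ* m                                                   ∎
    where
    open ≡-Reasoning
    dist : ∀ s P → s + P * s ≡ (P + 1) * s
    dist = solve-∀

-- Nonresidues by descent modulo 8.

data ParityView : ℕ → Set where
  even : ∀ t → ParityView (2 * t)
  odd  : ∀ t → ParityView (1 + 2 * t)

parityView : ∀ n → ParityView n
parityView zero = even 0
parityView (suc n) with parityView n
... | even t = odd t
... | odd t  = subst ParityView (lem t) (even (suc t))
  where
  lem : ∀ t → 2 * suc t ≡ suc (suc (2 * t))
  lem = solve-∀

%8%2 : ∀ n → n % 8 % 2 ≡ n % 2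
%8%2 n = m∣n⇒o%n%m≡o%m 2 8 n (divides 4 refl)

-- If m ∣ z² + c with z < m of the right parity, then the cofactor is smaller
-- than m and lies in the same residue classes modulo 8.
module Descent
  (c π : ℕ) .{{_ : NonZero c}} (Bad : ℕ → Set)
  (bad⇒> : ∀ {m} → Bad (m % 8) → c < m)
  (flip-parity : ∀ {m} → m < 8 → ∀ {y} → y < 8 → ∀ {z} → z < 8 → Bad m → (z + y) % 8 ≡ m → y % 2 ≢ π → z % 2 ≡ π)
  (cofactor-bad : ∀ {m} → m < 8 → ∀ {k} → k < 8 → ∀ {z} → z < 8 → Bad m → z % 2 ≡ π →
                  (z * z + c) % 8 ≡ (k * m) % 8 → Bad k)
  where

  private
    square-mod : ∀ x y m k → x ≡ y + k * m → m ∣ x * x + c → m ∣ y * y + c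
    square-mod x y m k refl m∣ = ∣m+n∣m⇒∣n
      (subst (m ∣_) (lem y k m c) m∣) (m∣m*n (k * (2 * y + k * m)))
      where
      lem : ∀ y k m c → (y + k * m) * (y + k * m) + c ≡ m * (k * (2 * y + k * m)) + (y * y + c)
      lem = solve-∀

    reflect : ∀ y z m → z + y ≡ m → m ∣ y * y + c → m ∣ z * z + c
    reflect y z _ refl m∣ = ∣m+n∣m⇒∣n
      (subst (z + y ∣_) (lem y z c) (∣m∣n⇒∣m+n m∣ (m∣m*n (z + y)))) (m∣m*n (2 * y))
      where
      lem : ∀ y z c → (y * y + c) + (z + y) * (z + y) ≡ (z + y) * (2 * y) + (z * z + c)
      lem = solve-∀

    reduce : ∀ m x → Bad (m % 8) → m ∣ x * x + c → ∃ λ z → z < m × z % 2 ≡ π × m ∣ z * z + c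
    reduce m x bad m∣ = go (x % m) (m%n<n x m) (square-mod x (x % m) m (x / m) (m≡m%n+[m/n]*n x m) m∣)
      where
      instance
        m≢0 : NonZero m
        m≢0 = >-nonZero (≤-<-trans z≤n (bad⇒> bad))
      go : ∀ y → y < m → m ∣ y * y + c → ∃ λ z → z < m × z % 2 ≡ π × m ∣ z * z + c
      go y y<m m∣y with y % 2 ≟ π
      ... | yes y-par = y , y<m , y-par , m∣y
      -- Reflection would send 0 to m itself, which is not below m; here m would divide c, against c
      -- < m.
      go zero _ m∣c | no _ = contradiction (∣⇒≤ m∣c) (<⇒≱ (bad⇒> bad))
      go y@(suc _) y<m m∣y | no ¬y-par =
        m ∸ y , ∸-monoʳ-< z<s (<⇒≤ y<m) ,
        trans (sym (%8%2 (m ∸ y)))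
          (flip-parity (m%n<n m 8) (m%n<n y 8) (m%n<n (m ∸ y) 8) bad
            (trans (sym (%-distribˡ-+ (m ∸ y) y 8)) (cong (_% 8) z+y≡m))
            (λ eq → ¬y-par (trans (sym (%8%2 y)) eq))) ,
        reflect y (m ∸ y) m z+y≡m m∣y
        where
        z+y≡m : m ∸ y + y ≡ m
        z+y≡m = m∸n+n≡m (<⇒≤ y<m)

  ∤square+ : ∀ m → Bad (m % 8) → ∀ x → m ∤ x * x + c
  ∤square+ = <-rec (λ m → Bad (m % 8) → ∀ x → m ∤ x * x + c) step
    where
    step : ∀ m → (∀ {k} → k < m → Bad (k % 8) → ∀ x → k ∤ x * x + c) → Bad (m % 8) → ∀ x → m ∤ x * x + c
    step m rec bad x m∣ with z , z<m , z-par , divides k eq ← reduce m x bad m∣ =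
      rec (*-cancelʳ-< m k m (subst (_< m * m) eq small))
          (cofactor-bad (m%n<n m 8) (m%n<n k 8) (m%n<n z 8) bad (trans (%8%2 z) z-par) residues)
          z (divides m (trans eq (*-comm k m)))
      where
      small : z * z + c < m * m
      small = begin-strict
        z * z + c  <⟨ +-monoʳ-< (z * z) (bad⇒> bad) ⟩
        z * z + m  ≤⟨ +-monoˡ-≤ m (*-monoʳ-≤ z (<⇒≤ z<m)) ⟩
        z * m + m  ≡⟨ +-comm (z * m) m ⟩
        suc z * m  ≤⟨ *-monoˡ-≤ m z<m ⟩
        m * m      ∎
        where open ≤-Reasoning
      residues : ((z % 8) * (z % 8) + c) % 8 ≡ ((k % 8) * (m % 8)) % 8
      residues = begin
        ((z % 8) * (z % 8) + c) % 8                   ≡⟨ %-distribˡ-+ ((z % 8) * (z % 8)) c 8 ⟩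
        (((z % 8) * (z % 8)) % 8 + c % 8) % 8         ≡⟨ cong (λ t → (t + c % 8) % 8) (%-distribˡ-* z z 8) ⟨
        ((z * z) % 8 + c % 8) % 8                     ≡⟨ %-distribˡ-+ (z * z) c 8 ⟨
        (z * z + c) % 8                               ≡⟨ cong (_% 8) eq ⟩
        (k * m) % 8                                   ≡⟨ %-distribˡ-* k m 8 ⟩
        ((k % 8) * (m % 8)) % 8                       ∎
        where open ≡-Reasoning

ThreeMod4 : ℕ → Set
ThreeMod4 r = r ≡ 3 ⊎ r ≡ 7

FiveOrSeven : ℕ → Set
FiveOrSeven r = r ≡ 5 ⊎ r ≡ 7

private
  three? : Decidable ThreeMod4
  three? r = (r ≟ 3) ⊎-dec (r ≟ 7)
  five? : Decidable FiveOrSeven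
  five? r = (r ≟ 5) ⊎-dec (r ≟ 7)

  <residue : ∀ {c r} m → m % 8 ≡ r → c < r → c < m
  <residue m refl c<r = <-≤-trans c<r (m%n≤m m 8)

-- For even z, z² + 1 ≡ 1 modulo 4, so the cofactor of a divisor ≡ 3 is again ≡ 3.
3mod4∤square+1 : ∀ m → ThreeMod4 (m % 8) → ∀ x → m ∤ x * x + 1
3mod4∤square+1 = Descent.∤square+ 1 0 ThreeMod4
  (λ { {m} (inj₁ eq) → <residue m eq (from-yes (1 <? 3)) ; {m} (inj₂ eq) → <residue m eq (from-yes (1 <? 7)) })
  (from-yes (allUpTo? (λ m → allUpTo? (λ y → allUpTo? (λ z →
    three? m →-dec (((z + y) % 8 ≟ m) →-dec (¬? (y % 2 ≟ 0) →-dec (z % 2 ≟ 0)))) 8) 8) 8))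
  (from-yes (allUpTo? (λ m → allUpTo? (λ k → allUpTo? (λ z →
    three? m →-dec ((z % 2 ≟ 0) →-dec (((z * z + 1) % 8 ≟ (k * m) % 8) →-dec three? k))) 8) 8) 8))

-- For odd z, z² + 2 ≡ 3 modulo 8, so the descent exchanges the classes 5 and 7. Only 7 is applied
-- later, but it is not stable alone.
5or7mod8∤square+2 : ∀ m → FiveOrSeven (m % 8) → ∀ x → m ∤ x * x + 2
5or7mod8∤square+2 = Descent.∤square+ 2 1 FiveOrSeven
  (λ { {m} (inj₁ eq) → <residue m eq (from-yes (2 <? 5)) ; {m} (inj₂ eq) → <residue m eq (from-yes (2 <? 7)) })
  (from-yes (allUpTo? (λ m → allUpTo? (λ y → allUpTo? (λ z →
    five? m →-dec (((z + y) % 8 ≟ m) →-dec (¬? (y % 2 ≟ 1) →-dec (z % 2 ≟ 1)))) 8) 8) 8))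
  (from-yes (allUpTo? (λ m → allUpTo? (λ k → allUpTo? (λ z →
    five? m →-dec ((z % 2 ≟ 1) →-dec (((z * z + 2) % 8 ≟ (k * m) % 8) →-dec five? k))) 8) 8) 8))

-- Odd squares are 1 modulo 8, so only the parity of the exponent matters.
odd⇒^-residue : ∀ p e → p % 2 ≡ 1 → p ^ e % 8 ≡ 1 ⊎ p ^ e % 8 ≡ p % 8
odd⇒^-residue p zero    _     = inj₁ refl
odd⇒^-residue p (suc e) p-odd = subst (λ r → r ≡ 1 ⊎ r ≡ p % 8) (sym (%-distribˡ-* p (p ^ e) 8))
  (check (m%n<n p 8) (m%n<n (p ^ e) 8) (trans (%8%2 p) p-odd) (odd⇒^-residue p e p-odd))
  where
  check : ∀ {r} → r < 8 → ∀ {s} → s < 8 → r % 2 ≡ 1 → s ≡ 1 ⊎ s ≡ r → (r * s) % 8 ≡ 1 ⊎ (r * s) % 8 ≡ r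
  check = from-yes (allUpTo? (λ r → allUpTo? (λ s → (r % 2 ≟ 1) →-dec
    (((s ≟ 1) ⊎-dec (s ≟ r)) →-dec (((r * s) % 8 ≟ 1) ⊎-dec ((r * s) % 8 ≟ r)))) 8) 8)

Odd : ℕ → Set
Odd n = ∃ λ t → n ≡ 1 + 2 * t

^-%≡1 : ∀ {k} n e → n % (2 + k) ≡ 1 → n ^ e % (2 + k) ≡ 1
^-%≡1     n zero    _  = refl
^-%≡1 {k} n (suc e) eq = trans (%-distribˡ-* n (n ^ e) (2 + k))
  (cong₂ (λ x y → (x * y) % (2 + k)) eq (^-%≡1 n e eq))

odd-^ : ∀ n e → n % 2 ≡ 1 → n ^ e % 2 ≡ 1
odd-^ = ^-%≡1

odd⇒2∤ : ∀ {n} → n % 2 ≡ 1 → 2 ∤ n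
odd⇒2∤ {n} eq 2∣n = contradiction (trans (sym eq) (n∣m⇒m%n≡0 n 2 2∣n)) λ ()

2∤⇒odd : ∀ {n} → 2 ∤ n → n % 2 ≡ 1
2∤⇒odd {n} 2∤n with n % 2 in eq | m%n<n n 2
... | 0 | _ = contradiction (m%n≡0⇒n∣m n 2 eq) 2∤n
... | 1 | _ = refl
... | suc (suc _) | s≤s (s≤s ())

odd⇒2∣+1 : ∀ {n} → n % 2 ≡ 1 → 2 ∣ n + 1
odd⇒2∣+1 {n} eq = m%n≡0⇒n∣m (n + 1) 2 (trans (%-distribˡ-+ n 1 2) (cong (λ r → (r + 1) % 2) eq))

^-double : ∀ n t → n ^ (2 * t) ≡ n ^ t * n ^ t
^-double n t = trans (cong (n ^_) (cong (t +_) (+-identityʳ t))) (^-distribˡ-+-* n t t)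

-- Prime power components and their admissible exponents.

record Component (q a b : ℕ) : Set where
  constructor component
  field
    p e     : ℕ
    isPrime : Prime p
    isOdd   : p % 2 ≡ 1
    value   : p ^ suc e + 1 ≡ 2 ^ a * q ^ b

module _ {q a b} (C : Component q a b) where
  open Component C

  p∣p^ : p ∣ p ^ suc e
  p∣p^ = m∣m*n (p ^ e)

  private
    residue : ∀ {A X} → p ^ suc e + 1 ≡ A * X → (p ^ suc e % 8 + 1) % 8 ≡ ((A % 8) * (X % 8)) % 8
    residue {A} {X} eq = trans (sym (%-distribˡ-+ (p ^ suc e) 1 8)) (trans (cong (_% 8) eq) (%-distribˡ-* A X 8))

  -- Divisibility by 4 rules out p^e ≡ 1 modulo 8, which leaves p^e ≡ p; the residue of the power
  -- thus passes to p.
  residue-4∣ : ∀ {X} → p ^ suc e + 1 ≡ 4 * X → ThreeMod4 (p % 8)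
  residue-4∣ {X} eq with odd⇒^-residue p (suc e) isOdd | check (m%n<n (p ^ suc e) 8) (m%n<n X 8) (residue {4} {X} eq)
    where
    check : ∀ {r} → r < 8 → ∀ {s} → s < 8 → (r + 1) % 8 ≡ (4 * s) % 8 → ThreeMod4 r
    check = from-yes (allUpTo? (λ r → allUpTo? (λ s →
      ((r + 1) % 8 ≟ (4 * s) % 8) →-dec ((r ≟ 3) ⊎-dec (r ≟ 7))) 8) 8)
  ... | inj₂ eq′ | three = subst ThreeMod4 eq′ three
  ... | inj₁ eq′ | inj₁ three = contradiction (trans (sym eq′) three) λ ()
  ... | inj₁ eq′ | inj₂ seven = contradiction (trans (sym eq′) seven) λ ()

  residue-8∣ : ∀ {X} → p ^ suc e + 1 ≡ 8 * X → p % 8 ≡ 7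
  residue-8∣ {X} eq with odd⇒^-residue p (suc e) isOdd | check (m%n<n (p ^ suc e) 8) (m%n<n X 8) (residue {8} {X} eq)
    where
    check : ∀ {r} → r < 8 → ∀ {s} → s < 8 → (r + 1) % 8 ≡ (0 * s) % 8 → r ≡ 7
    check = from-yes (allUpTo? (λ r → allUpTo? (λ s →
      ((r + 1) % 8 ≟ (0 * s) % 8) →-dec (r ≟ 7)) 8) 8)
  ... | inj₂ eq′ | seven = trans (sym eq′) seven
  ... | inj₁ eq′ | seven with () ← trans (sym eq′) seven

  p^1+e>1 : 1 < p ^ suc e
  p^1+e>1 = m^1+n>1 e (prime>1 isPrime)

  p∤2 : p ∤ 2
  p∤2 p∣2 = contradiction (subst (λ r → r % 2 ≡ 1) (prime∣prime isPrime prime[2] p∣2) isOdd) λ ()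

  -- x² - 1 = (x - 1)(x + 1) is an odd prime power only for x = 2.
  square⇒≡2 : ∀ x → p ^ suc e + 1 ≡ x * x → x ≡ 2
  square⇒≡2 zero eq = contradiction (trans (+-comm 1 _) eq) λ ()
  square⇒≡2 (suc zero) eq = contradiction (+-cancelʳ-≡ 1 (p ^ suc e) 0 eq) (>⇒≢ (<-trans z<s p^1+e>1))
  square⇒≡2 (suc (suc zero)) eq = refl
  square⇒≡2 (suc y@(suc (suc _))) eq = contradiction (∣m+n∣m⇒∣n (p∣ (y + 2) (m≤n+m 2 y) (n∣m*n y)) (p∣ y (s≤s (s≤s z≤n)) (m∣m*n (y + 2)))) p∤2
    where
    factored : p ^ suc e ≡ y * (y + 2)
    factored = +-cancelʳ-≡ 1 (p ^ suc e) (y * (y + 2)) (trans eq (lem y))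
      where
      lem : ∀ y → suc y * suc y ≡ y * (y + 2) + 1
      lem = solve-∀
    p∣ : ∀ d → 1 < d → d ∣ y * (y + 2) → p ∣ d
    p∣ d 1<d d∣ with r , rp , r∣d ← prime-divisor 1<d =
      subst (_∣ d) (prime∣prime rp isPrime (prime∣^ p (suc e) rp (subst (r ∣_) (sym factored) (∣-trans r∣d d∣)))) r∣d

private
  -- Multiply q^g ≡ -1 by 2^a q^b ≡ 1 (mod p).
  shift-sum : ∀ {q a b} (C : Component q a b) g → let open Component C in
              p ∣ q ^ g + 1 → p ∣ 2 ^ a * q ^ (b + g) + 1
  shift-sum {q} {a} {b} C g p∣ = ∣m+n∣m⇒∣n (subst (p ∣_) eq (∣n⇒∣m*n (2 ^ a * q ^ b) p∣)) (p∣p^ C)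
    where
    open Component C
    eq : 2 ^ a * q ^ b * (q ^ g + 1) ≡ p ^ suc e + (2 ^ a * q ^ (b + g) + 1)
    eq = begin
      2 ^ a * q ^ b * (q ^ g + 1)             ≡⟨ l₁ (2 ^ a) (q ^ b) (q ^ g) ⟩
      2 ^ a * q ^ b + 2 ^ a * (q ^ b * q ^ g) ≡⟨ cong₂ (λ u v → u + 2 ^ a * v) (sym value) (sym (^-distribˡ-+-* q b g)) ⟩
      p ^ suc e + 1 + 2 ^ a * q ^ (b + g)     ≡⟨ l₂ (p ^ suc e) (2 ^ a * q ^ (b + g)) ⟩
      p ^ suc e + (2 ^ a * q ^ (b + g) + 1)   ∎
      where
      open ≡-Reasoning
      l₁ : ∀ x y z → x * y * (z + 1) ≡ x * y + x * (y * z)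
      l₁ = solve-∀
      l₂ : ∀ x y → x + 1 + y ≡ x + (y + 1)
      l₂ = solve-∀

  odd+odd : ∀ s t → 1 + 2 * s + (1 + 2 * t) ≡ 2 * (1 + s + t)
  odd+odd = solve-∀

module _ (p : ℕ) where
  ∤even-power+1 : ThreeMod4 (p % 8) → ∀ n t → p ∤ n ^ (2 * t) + 1
  ∤even-power+1 three n t p∣ = 3mod4∤square+1 p three (n ^ t) (subst (λ x → p ∣ x + 1) (^-double n t) p∣)

  -- For even f this is the case of -1. For odd f, 2(2^f + 1) has the form x² + 2.
  ∤2^+1 : p % 8 ≡ 7 → ∀ f → p ∤ 2 ^ f + 1
  ∤2^+1 seven f p∣ with parityView f
  ... | even t = ∤even-power+1 (inj₂ seven) 2 t p∣
  ... | odd t  = 5or7mod8∤square+2 p (inj₂ seven) (2 * 2 ^ t) (subst (p ∣_) (trans (cong (λ x → 2 * (2 * x + 1)) (^-double 2 t)) (lem (2 ^ t))) (∣n⇒∣m*n 2 p∣))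
    where
    lem : ∀ x → 2 * (2 * (x * x) + 1) ≡ 2 * x * (2 * x) + 2
    lem = solve-∀

-- `shift-sum` gives p ∣ 2^a q^(b + g) + 1, and both exponents are even, so -1 would be a square
-- modulo p.
∤q^odd+1-even : ∀ {q a s} (C : Component q a (1 + 2 * s)) → let open Component C in
                ThreeMod4 (p % 8) → ∀ r → a ≡ 2 * r → ∀ t → p ∤ q ^ (1 + 2 * t) + 1
∤q^odd+1-even {q} {a} {s} C three r refl t p∣ =
  3mod4∤square+1 p three (2 ^ r * q ^ (1 + s + t)) (subst (λ x → p ∣ x + 1)
    (trans (cong₂ _*_ (^-double 2 r) (trans (cong (q ^_) (odd+odd s t)) (^-double q (1 + s + t))))
           (lem (2 ^ r) (q ^ (1 + s + t))))
    (shift-sum C (1 + 2 * t) p∣))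
  where
  open Component C
  lem : ∀ x y → x * x * (y * y) ≡ x * y * (x * y)
  lem = solve-∀

-- As for even a, but doubling is needed to make the power of 2 a square, so -2 takes the place of
-- -1.
∤q^odd+1-odd : ∀ {q a s} (C : Component q a (1 + 2 * s)) → let open Component C in
               p % 8 ≡ 7 → ∀ r → a ≡ 1 + 2 * r → ∀ t → p ∤ q ^ (1 + 2 * t) + 1
∤q^odd+1-odd {q} {a} {s} C seven r refl t p∣ =
  5or7mod8∤square+2 p (inj₂ seven) (2 * 2 ^ r * q ^ (1 + s + t)) (subst (p ∣_)
    (trans (cong₂ (λ x y → 2 * (2 * x * y + 1)) (^-double 2 r) (trans (cong (q ^_) (odd+odd s t)) (^-double q (1 + s + t))))
           (lem (2 ^ r) (q ^ (1 + s + t))))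
    (∣n⇒∣m*n 2 (shift-sum C (1 + 2 * t) p∣)))
  where
  open Component C
  lem : ∀ x y → 2 * (2 * (x * x) * (y * y) + 1) ≡ 2 * x * y * (2 * x * y) + 2
  lem = solve-∀

n^e≡1⇒e≡0 : ∀ n e → 1 < n → n ^ e ≡ 1 → e ≡ 0
n^e≡1⇒e≡0 n zero    _   _  = refl
n^e≡1⇒e≡0 n (suc e) 1<n eq = contradiction eq (>⇒≢ (m^1+n>1 e 1<n))

-- With both exponents even, 2^a q^b is a square, hence 4 by `square⇒≡2`.
square-component : ∀ {q} s t → 1 < q → Component q (2 * suc s) (2 * t) → s ≡ 0 × t ≡ 0
square-component {q} s t 1<q C = n^e≡1⇒e≡0 2 s (s≤s (s≤s z≤n)) (m*n≡1⇒m≡1 (2 ^ s) (q ^ t) one) ,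
                          n^e≡1⇒e≡0 q t 1<q (m*n≡1⇒n≡1 (2 ^ s) (q ^ t) one)
  where
  open Component C
  lem : ∀ x y → x * x * (y * y) ≡ x * y * (x * y)
  lem = solve-∀
  one : 2 ^ s * q ^ t ≡ 1
  one = *-cancelˡ-≡ _ 1 2 (trans (sym (*-assoc 2 (2 ^ s) (q ^ t))) (square⇒≡2 C (2 ^ suc s * q ^ t)
    (trans value (trans (cong₂ _*_ (^-double 2 (suc s)) (^-double q t)) (lem (2 ^ suc s) (q ^ t))))))

-- Each shape carries the parity of f or g that it requires, so fixing these parities deletes
-- shapes. `high` also keeps a divisor ≡ 7 modulo 8 of q^g + 1, which excludes it when q = 5 and g =
-- 1.
data Shape (q f g : ℕ) : ℕ → ℕ → Set where
  one   : ∀ b → Shape q f g 1 (suc b)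
  three : Odd f ⊎ Odd g → Shape q f g 2 0
  two   : Odd f → ∀ t → Shape q f g 2 (1 + 2 * t)
  high  : Odd g → (∃ λ p → p % 8 ≡ 7 × p ∣ q ^ g + 1) → ∀ s t → Shape q f g (3 + 2 * s) (2 * t)

-- The prime divides 2^f + 1 or q^g + 1. For a ≥ 2, in every omitted pattern of parities this makes
-- -1 or -2 a square modulo p, or else 2^a q^b is a square other than 4.
classify : ∀ {q f g a b} → 1 < q → q % 2 ≡ 1 → (C : Component q a b) → Component.p C ∣ (2 ^ f + 1) * (q ^ g + 1) → Shape q f g a b
classify {q} {a = zero} {b} _ q-odd C _ =
  contradiction (subst (2 ∣_) (trans value (*-identityˡ (q ^ b))) (odd⇒2∣+1 (odd-^ p (suc e) isOdd))) (odd⇒2∤ (odd-^ q b q-odd))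
  where open Component C
classify {a = suc zero} {zero} _ _ C _ = contradiction (+-cancelʳ-≡ 1 (p ^ suc e) 1 value) (>⇒≢ (p^1+e>1 C))
  where open Component C
classify {a = suc zero} {suc b} _ _ _ _ = one b
classify {q} {f} {g} {a = suc (suc zero)} {b} 1<q q-odd C p∣ = go (euclidsLemma (2 ^ f + 1) (q ^ g + 1) isPrime p∣) (parityView f) (parityView g) (parityView b)
  where
  open Component C
  3mod4 : ThreeMod4 (p % 8)
  3mod4 = residue-4∣ C {q ^ b} value
  go : p ∣ 2 ^ f + 1 ⊎ p ∣ q ^ g + 1 → ParityView f → ParityView g → ParityView b → Shape q f g 2 b
  go (inj₁ p∣f) (even t) _ _       = contradiction p∣f (∤even-power+1 p 3mod4 2 t)
  go (inj₁ p∣f) (odd t) _ (odd s)  = two (t , refl) s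
  go (inj₁ p∣f) (odd t) _ (even s) with refl ← proj₂ (square-component 0 s 1<q C) = three (inj₁ (t , refl))
  go (inj₂ p∣g) _ (even t) _       = contradiction p∣g (∤even-power+1 p 3mod4 q t)
  go (inj₂ p∣g) _ (odd t) (odd s)  = contradiction p∣g (∤q^odd+1-even {s = s} C 3mod4 1 refl t)
  go (inj₂ p∣g) _ (odd t) (even s) with refl ← proj₂ (square-component 0 s 1<q C) = three (inj₂ (t , refl))
classify {q} {f} {g} {a = suc (suc (suc a))} {b} 1<q q-odd C p∣ = go (euclidsLemma (2 ^ f + 1) (q ^ g + 1) isPrime p∣) (parityView a) (parityView g) (parityView b)
  where
  open Component C
  seven : p % 8 ≡ 7
  seven = residue-8∣ C {2 ^ a * q ^ b} (trans value (lem (2 ^ a) (q ^ b)))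
    where
    lem : ∀ x y → 2 * (2 * (2 * x)) * y ≡ 8 * (x * y)
    lem = solve-∀
  4+2* : ∀ s → 3 + (1 + 2 * s) ≡ 2 * (2 + s)
  4+2* = solve-∀
  3+2* : ∀ s → 3 + 2 * s ≡ 1 + 2 * (1 + s)
  3+2* = solve-∀
  go : p ∣ 2 ^ f + 1 ⊎ p ∣ q ^ g + 1 → ParityView a → ParityView g → ParityView b → Shape q f g (3 + a) b
  go (inj₁ p∣f) _ _ _ = contradiction p∣f (∤2^+1 p seven f)
  go (inj₂ p∣g) _ (even t) _ = contradiction p∣g (∤even-power+1 p (inj₂ seven) q t)
  go (inj₂ p∣g) (even s) (odd t) (even r) = high (t , refl) (p , seven , p∣g) s r
  go (inj₂ p∣g) (even s) (odd t) (odd r)  = contradiction p∣g (∤q^odd+1-odd {s = r} C seven (1 + s) (3+2* s) t)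
  go (inj₂ p∣g) (odd s)  (odd t) (odd r)  = contradiction p∣g (∤q^odd+1-even {s = r} C (inj₂ seven) (2 + s) (4+2* s) t)
  go (inj₂ p∣g) (odd s)  (odd t) (even r) with () ← proj₁ (square-component (1 + s) r 1<q (subst (λ x → Component q x (2 * r)) (4+2* s) C))

-- A component p^e with p^e + 1 = 2^a q^b is represented by its exponent pair (a , b).
module _ (q : ℕ) where
  val+1 : ℕ × ℕ → ℕ
  val+1 (a , b) = 2 ^ a * q ^ b

  val : ℕ × ℕ → ℕ
  val x = val+1 x ∸ 1

-- Decomposition of N and the two primes of `σ*` N.

smooth : ∀ {q} → Prime q → ∀ d → 0 < d → (∀ {r} → Prime r → r ∣ d → r ≡ 2 ⊎ r ≡ q) → ∃₂ λ a b → d ≡ 2 ^ a * q ^ b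
smooth {q} pq d 0<d only with a , d₁ , eq₁ , 2∤d₁ , 0<d₁ ← extract-power 2 d (s≤s (s≤s z≤n)) 0<d
  with b , d₂ , eq₂ , q∤d₂ , 0<d₂ ← extract-power q d₁ (prime>1 pq) 0<d₁ =
  a , b , trans eq₁ (cong (2 ^ a *_) (trans eq₂ (trans (cong (q ^ b *_) d₂≡1) (*-identityʳ (q ^ b)))))
  where
  d₂∣d₁ : d₂ ∣ d₁
  d₂∣d₁ = divides (q ^ b) eq₂
  d₂∣d : d₂ ∣ d
  d₂∣d = ∣-trans d₂∣d₁ (divides (2 ^ a) eq₁)
  d₂≡1 : d₂ ≡ 1
  d₂≡1 with 1 <? d₂
  ... | no d₂≤1 = ≤-antisym (≮⇒≥ d₂≤1) 0<d₂
  ... | yes 1<d₂ with r , pr , r∣ ← prime-divisor 1<d₂ with only pr (∣-trans r∣ d₂∣d)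
  ...   | inj₁ refl = contradiction (∣-trans r∣ d₂∣d₁) 2∤d₁
  ...   | inj₂ refl = contradiction r∣ q∤d₂

record Components (q n : ℕ) : Set where
  field
    exponents  : List (ℕ × ℕ)
    components : All (λ (a , b) → ∃ λ (C : Component q a b) → Component.p C ∣ n) exponents
    coprime    : AllPairs (λ x y → Coprime (val q x) (val q y)) exponents
    product-val   : product (map (val q) exponents) ≡ n
    product-val+1 : product (map (val+1 q) exponents) ≡ σ* n

component-val : ∀ {q a b} (C : Component q a b) → let open Component C in val q (a , b) ≡ p ^ suc e
component-val C = trans (cong (_∸ 1) (sym value)) (m+n∸n≡m (p ^ suc e) 1)
  where open Component C

odd-* : ∀ m n → (m * n) % 2 ≡ 1 → m % 2 ≡ 1 × n % 2 ≡ 1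
odd-* m n mn-odd = 2∤⇒odd {m} (λ 2∣m → odd⇒2∤ {m * n} mn-odd (∣m⇒∣m*n {m = m} n 2∣m)) , 2∤⇒odd {n} (λ 2∣n → odd⇒2∤ {m * n} mn-odd (∣n⇒∣m*n m 2∣n))

decompose : ∀ {q} → Prime q → ∀ n → 0 < n → n % 2 ≡ 1 → (∀ {r} → Prime r → r ∣ σ* n → r ≡ 2 ⊎ r ≡ q) → Components q n
decompose {q} pq = <-rec (λ n → 0 < n → n % 2 ≡ 1 → (∀ {r} → Prime r → r ∣ σ* n → r ≡ 2 ⊎ r ≡ q) → Components q n) step
  where
  step : ∀ n → (∀ {m} → m < n → 0 < m → m % 2 ≡ 1 → (∀ {r} → Prime r → r ∣ σ* m → r ≡ 2 ⊎ r ≡ q) → Components q m) →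
         0 < n → n % 2 ≡ 1 → (∀ {r} → Prime r → r ∣ σ* n → r ≡ 2 ⊎ r ≡ q) → Components q n
  step (suc zero) rec _ _ _ = record { exponents = [] ; components = [] ; coprime = [] ; product-val = refl ; product-val+1 = refl }
  step n@(suc (suc _)) rec _ n-odd only
    with p , e , m , pr , eq , p∤m , 0<m , m<n ← extract-prime {n} (s≤s (s≤s z≤n)) = result
    where
    σ*-n : σ* n ≡ (p ^ suc e + 1) * σ* m
    σ*-n = trans (cong σ* eq) (σ*-prime-power-* pr e 0<m p∤m)
    odds : p ^ suc e % 2 ≡ 1 × m % 2 ≡ 1
    odds = odd-* (p ^ suc e) m (subst (λ x → x % 2 ≡ 1) eq n-odd)
    only-m : ∀ {r} → Prime r → r ∣ σ* m → r ≡ 2 ⊎ r ≡ q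
    only-m rp r∣ = only rp (subst (_ ∣_) (sym σ*-n) (∣n⇒∣m*n (p ^ suc e + 1) r∣))
    only-P : ∀ {r} → Prime r → r ∣ p ^ suc e + 1 → r ≡ 2 ⊎ r ≡ q
    only-P rp r∣ = only rp (subst (_ ∣_) (sym σ*-n) (∣m⇒∣m*n (σ* m) r∣))
    open Components (rec m<n 0<m (proj₂ odds) only-m)
    result : Components q n
    result with a , b , val-eq ← smooth pq (p ^ suc e + 1) (subst (0 <_) (+-comm 1 _) z<s) only-P = record
      { exponents = (a , b) ∷ exponents
      ; components = (C , divides (p ^ e * m) (trans eq (lem p (p ^ e) m))) ∷
          All.map (λ (C , p∣m) → C , ∣-trans p∣m (divides (p ^ suc e) eq)) components
      ; coprime = All.tabulate (λ {y} y∈ → coprime-∣ (prime∤⇒coprime-^ (suc e) pr p∤m)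
            (∣-reflexive (component-val C)) (subst (val q y ∣_) product-val (∈⇒∣product (∈-map⁺ (val q) y∈)))) ∷ coprime
      ; product-val = trans (cong₂ _*_ (component-val C) product-val) (sym eq)
      ; product-val+1 = trans (cong₂ _*_ (sym val-eq) product-val+1) (sym σ*-n)
      }
      where
      C : Component q a b
      C = component p e pr (proj₁ (odd-* p (p ^ e) (proj₁ odds))) val-eq
      lem : ∀ p x m → p * x * m ≡ x * m * p
      lem = solve-∀

σ*-even : ∀ {n} → 1 < n → n % 2 ≡ 1 → 2 ∣ σ* n
σ*-even {n} 1<n n-odd with p , e , m , pr , eq , p∤m , 0<m , _ ← extract-prime 1<n =
  subst (2 ∣_) (sym (trans (cong σ* eq) (σ*-prime-power-* pr e 0<m p∤m)))
    (∣m⇒∣m*n (σ* m) (odd⇒2∣+1 {p ^ suc e} (proj₁ (odd-* (p ^ suc e) m (subst (λ x → x % 2 ≡ 1) eq n-odd)))))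

record TwoPrimes (N : ℕ) : Set where
  field
    f g q   : ℕ
    q-prime : Prime q
    q-odd   : q % 2 ≡ 1
    σ*-N    : σ* N ≡ 2 ^ suc f * q ^ suc g
    2N      : 2 * N ≡ (2 ^ suc f + 1) * (q ^ suc g + 1)

-- Every odd prime power exactly dividing `σ*` N contributes an even factor to 2N, and N is odd, so
-- there is at most one. With none, 2N would be 2^f + 1, which is odd.
σ*-two-primes : ∀ {N} → N % 2 ≡ 1 → σ* (σ* N) ≡ 2 * N → TwoPrimes N
σ*-two-primes {zero} ()
σ*-two-primes {suc zero} _ ()
σ*-two-primes {N@(suc (suc _))} N-odd perfect with σ* N in s-eq
... | zero = contradiction perfect λ ()
... | s@(suc _) with extract-power 2 s (s≤s (s≤s z≤n)) z<s
... | zero , m , eq , 2∤m , _ =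
  contradiction (subst (2 ∣_) (trans s-eq (trans eq (*-identityˡ m))) (σ*-even {N} (s≤s (s≤s z≤n)) N-odd)) 2∤m
... | suc f , suc zero , eq , _ , _ = contradiction (divides N (trans (sym 2N-eq) (*-comm 2 N))) (λ 2∣ →
      odd⇒2∤ {1} refl (∣m+n∣m⇒∣n 2∣ (m∣m*n (2 ^ f))))
  where
  2N-eq : 2 * N ≡ 2 ^ suc f + 1
  2N-eq = trans (sym perfect) (trans (cong σ* eq) (trans (σ*-prime-power-* prime[2] f {1} z<s (prime∤1 prime[2])) (*-identityʳ _)))
... | suc f , m@(suc (suc _)) , eq , 2∤m , 0<m
  with q , g , m′ , pq , eq′ , q∤m′ , 0<m′ , _ ← extract-prime {m} (s≤s (s≤s z≤n)) = result
  where
  m-odds : q ^ suc g % 2 ≡ 1 × m′ % 2 ≡ 1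
  m-odds = odd-* (q ^ suc g) m′ (subst (λ x → x % 2 ≡ 1) eq′ (2∤⇒odd 2∤m))
  2N-eq : 2 * N ≡ (2 ^ suc f + 1) * ((q ^ suc g + 1) * σ* m′)
  2N-eq = trans (sym perfect) (trans (cong σ* eq) (trans (σ*-prime-power-* prime[2] f {m} 0<m 2∤m)
    (cong ((2 ^ suc f + 1) *_) (trans (cong σ* eq′) (σ*-prime-power-* pq g 0<m′ q∤m′)))))
  m′≡1 : m′ ≡ 1
  m′≡1 with 1 <? m′
  ... | no m′≤1 = ≤-antisym (≮⇒≥ m′≤1) 0<m′
  ... | yes 1<m′ = contradiction
    (*-cancelˡ-∣ {2} {N} 2 (subst (4 ∣_) (sym 2N-eq) (∣n⇒∣m*n (2 ^ suc f + 1) (*-pres-∣ (odd⇒2∣+1 {q ^ suc g} (proj₁ m-odds)) (σ*-even 1<m′ (proj₂ m-odds))))))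
    (odd⇒2∤ N-odd)
  result : TwoPrimes N
  result = record
    { f = f ; g = g ; q = q ; q-prime = pq
    ; q-odd = proj₁ (odd-* q (q ^ g) (proj₁ m-odds))
    ; σ*-N = trans s-eq (trans eq (cong (2 ^ suc f *_) (trans eq′ (trans (cong (q ^ suc g *_) m′≡1) (*-identityʳ _)))))
    ; 2N = trans 2N-eq (cong ((2 ^ suc f + 1) *_) (trans (cong (λ z → (q ^ suc g + 1) * σ* z) m′≡1) (*-identityʳ _)))
    }

-- Sums of reciprocals over a common denominator.

sum-⊆ : ∀ {A : Set} (w : A → ℕ) {xs ys} → Unique xs → (∀ {x} → x ∈ xs → x ∈ ys) → sum (map w xs) ≤ sum (map w ys)
sum-⊆ w [] _ = z≤n
sum-⊆ w {x ∷ xs} (x∉xs ∷ uniq) sub with us , vs , refl ← ∈-∃++ (sub (here refl)) = begin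
  w x + sum (map w xs)            ≤⟨ +-monoʳ-≤ (w x) (sum-⊆ w uniq rest) ⟩
  sum (map w (x ∷ us ++ vs))      ≡⟨ sum-↭ (Perm.map⁺ w (↭-sym (shift x us vs))) ⟩
  sum (map w (us ++ x ∷ vs))      ∎
  where
  open ≤-Reasoning
  rest : ∀ {y} → y ∈ xs → y ∈ us ++ vs
  rest y∈ with ∈-resp-↭ (shift x us vs) (sub (there y∈))
  ... | here refl = contradiction refl (All.lookup x∉xs y∈)
  ... | there y∈′ = y∈′

-- The factor (1 + s)/s is the sum of the powers of 1/(1 + s). The ratio is required only inside the
-- range, since truncated weights stop decreasing beyond it.
geometric-sum : ∀ s (h : ℕ → ℕ) n → (∀ i → suc i < n → (1 + s) * h (suc i) ≤ h i) → s * sum (applyUpTo h n) ≤ (1 + s) * h 0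
geometric-sum s h zero _ = subst (_≤ (1 + s) * h 0) (sym (*-zeroʳ s)) z≤n
geometric-sum s h (suc zero) _ = subst (λ t → s * t ≤ (1 + s) * h 0) (sym (+-identityʳ (h 0))) (*-monoˡ-≤ (h 0) (n≤1+n s))
geometric-sum s h (suc (suc n)) ratio = begin
  s * (h 0 + S)          ≡⟨ *-distribˡ-+ s (h 0) S ⟩
  s * h 0 + s * S        ≤⟨ +-monoʳ-≤ (s * h 0) (geometric-sum s (h ∘ suc) (suc n) (λ i lt → ratio (suc i) (s≤s lt))) ⟩
  s * h 0 + (1 + s) * h 1 ≤⟨ +-monoʳ-≤ (s * h 0) (ratio 0 (s≤s (s≤s z≤n))) ⟩
  s * h 0 + h 0          ≡⟨ +-comm (s * h 0) (h 0) ⟩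
  (1 + s) * h 0          ∎
  where
  open ≤-Reasoning
  S = sum (applyUpTo (h ∘ suc) (suc n))

sum-map-concat : ∀ {A : Set} (w : A → ℕ) (row : ℕ → List A) n →
                 sum (map w (concat (applyUpTo row n))) ≡ sum (applyUpTo (λ j → sum (map w (row j))) n)
sum-map-concat w row zero = refl
sum-map-concat w row (suc n) = trans (cong sum (map-++ w (row 0) _))
  (trans (sum-++ (map w (row 0)) _) (cong (sum (map w (row 0)) +_) (sum-map-concat w (row ∘ suc) n)))

module Weights (q A B : ℕ) (0<q : 0 < q) where

  Q : ℕ × ℕ → ℕ
  Q = val+1 q

  K : ℕ
  K = 2 ^ A * q ^ B

  -- Truncated subtraction makes this a quotient of `K` only for exponents in range, hence the
  -- `InRange` hypotheses below.
  weight : ℕ × ℕ → ℕ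
  weight (a , b) = 2 ^ (A ∸ a) * q ^ (B ∸ b)

  InRange : ℕ × ℕ → Set
  InRange (a , b) = a ≤ A × b ≤ B

  private instance
    q≢0 : NonZero q
    q≢0 = >-nonZero 0<q

  Q>0 : ∀ x → 0 < Q x
  Q>0 (a , b) = >-nonZero⁻¹ _ {{m*n≢0 (2 ^ a) (q ^ b) {{m^n≢0 2 a}} {{m^n≢0 q b}}}}

  weight-Q : ∀ {x} → InRange x → weight x * Q x ≡ K
  weight-Q {a , b} (a≤A , b≤B) = trans (lem (2 ^ (A ∸ a)) (q ^ (B ∸ b)) (2 ^ a) (q ^ b))
    (cong₂ _*_ (split 2 a≤A) (split q b≤B))
    where
    lem : ∀ x y z t → x * y * (z * t) ≡ (x * z) * (y * t)
    lem = solve-∀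
    split : ∀ n {c C} → c ≤ C → n ^ (C ∸ c) * n ^ c ≡ n ^ C
    split n {c} {C} c≤C = trans (sym (^-distribˡ-+-* n (C ∸ c) c)) (cong (n ^_) (m∸n+n≡m c≤C))

  weight-ratio : ∀ r {x y} → InRange x → InRange y → r * Q x ≤ Q y → r * weight y ≤ weight x
  weight-ratio r {x} {y} x-in y-in rQ≤ = *-cancelʳ-≤ _ _ (Q x) {{>-nonZero (Q>0 x)}} (begin
    r * weight y * Q x   ≡⟨ lem r (weight y) (Q x) ⟩
    weight y * (r * Q x) ≤⟨ *-monoʳ-≤ (weight y) rQ≤ ⟩
    weight y * Q y       ≡⟨ trans (weight-Q y-in) (sym (weight-Q x-in)) ⟩
    weight x * Q x       ∎)
    where
    open ≤-Reasoning
    lem : ∀ r w Q → r * w * Q ≡ w * (r * Q)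
    lem = solve-∀

  -- Since weight x = K / Q x, this says that Σ 1/Q over the list is at most v/u.
  record Mass≤ (xs : List (ℕ × ℕ)) (u v : ℕ) : Set where
    constructor mass≤
    field bound : u * sum (map weight xs) ≤ v * K

  mass-++ : ∀ {xs ys u v u′ v′} → Mass≤ xs u v → Mass≤ ys u′ v′ → Mass≤ (xs ++ ys) (u * u′) (v * u′ + v′ * u)
  mass-++ {xs} {ys} {u} {v} {u′} {v′} (mass≤ p) (mass≤ p′) = mass≤ $ begin
    u * u′ * sum (map weight (xs ++ ys))  ≡⟨ cong (u * u′ *_) (trans (cong sum (map-++ weight xs ys)) (sum-++ (map weight xs) (map weight ys))) ⟩
    u * u′ * (S + S′)                     ≡⟨ l₁ u u′ S S′ ⟩
    u′ * (u * S) + u * (u′ * S′)          ≤⟨ +-mono-≤ (*-monoʳ-≤ u′ p) (*-monoʳ-≤ u p′) ⟩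
    u′ * (v * K) + u * (v′ * K)           ≡⟨ l₂ u u′ v v′ K ⟩
    (v * u′ + v′ * u) * K                 ∎
    where
    open ≤-Reasoning
    S  = sum (map weight xs)
    S′ = sum (map weight ys)
    l₁ : ∀ u u′ S S′ → u * u′ * (S + S′) ≡ u′ * (u * S) + u * (u′ * S′)
    l₁ = solve-∀
    l₂ : ∀ u u′ v v′ K → u′ * (v * K) + u * (v′ * K) ≡ (v * u′ + v′ * u) * K
    l₂ = solve-∀

  private
    head-mass : ∀ c L {x} → InRange x → L ≤ Q x → L * (c * weight x) ≤ c * K
    head-mass c L {x} x-in L≤ = begin
      L * (c * weight x)   ≤⟨ *-monoˡ-≤ (c * weight x) L≤ ⟩
      Q x * (c * weight x) ≡⟨ lem (Q x) c (weight x) ⟩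
      c * (weight x * Q x) ≡⟨ cong (c *_) (weight-Q x-in) ⟩
      c * K                ∎
      where
      open ≤-Reasoning
      lem : ∀ Q c w → Q * (c * w) ≡ c * (w * Q)
      lem = solve-∀

    row-sum : ∀ s (φ : ℕ → ℕ × ℕ) n → (∀ i → i < n → InRange (φ i)) →
              (∀ i → (1 + s) * Q (φ i) ≤ Q (φ (suc i))) →
              s * sum (map weight (applyUpTo φ n)) ≤ (1 + s) * weight (φ 0)
    row-sum s φ n φ-in ratio = subst (λ t → s * sum t ≤ (1 + s) * weight (φ 0)) (sym (map-applyUpTo φ weight n))
      (geometric-sum s (weight ∘ φ) n (λ i lt → weight-ratio (1 + s) (φ-in i (<-trans (n<1+n i) lt)) (φ-in (suc i) lt) (ratio i)))

  -- A series with first term at most 1/L and ratio at most 1/(1 + s) sums to at most (1 + s)/(L s).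
  geometric-mass : ∀ s L (φ : ℕ → ℕ × ℕ) n → InRange (φ 0) → (∀ i → i < n → InRange (φ i)) →
                   (∀ i → (1 + s) * Q (φ i) ≤ Q (φ (suc i))) → L ≤ Q (φ 0) →
                   Mass≤ (applyUpTo φ n) (L * s) (1 + s)
  geometric-mass s L φ n φ₀-in φ-in ratio L≤ = mass≤ $ begin
    L * s * S                       ≡⟨ *-assoc L s S ⟩
    L * (s * S)                     ≤⟨ *-monoʳ-≤ L (row-sum s φ n φ-in ratio) ⟩
    L * ((1 + s) * weight (φ 0))    ≤⟨ head-mass (1 + s) L φ₀-in L≤ ⟩
    (1 + s) * K                     ∎
    where
    open ≤-Reasoning
    S = sum (map weight (applyUpTo φ n))

  -- Each row is bounded through its first entry, then the first entries are summed as a second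
  -- geometric series.
  double-geometric-mass : ∀ s t L (φ : ℕ → ℕ → ℕ × ℕ) m n → InRange (φ 0 0) →
    (∀ j i → j < m → i < n → InRange (φ j i)) → (∀ j → j < m → InRange (φ j 0)) →
    (∀ j i → (1 + s) * Q (φ j i) ≤ Q (φ j (suc i))) → (∀ j → (1 + t) * Q (φ j 0) ≤ Q (φ (suc j) 0)) → L ≤ Q (φ 0 0) →
    Mass≤ (concat (applyUpTo (λ j → applyUpTo (φ j) n) m)) (L * t * s) ((1 + s) * (1 + t))
  double-geometric-mass s t L φ m n φ₀₀-in φ-in φ₀-in ratio ratio′ L≤ = mass≤ $ begin
    L * t * s * sum (map weight (concat (applyUpTo rows m)))   ≡⟨ cong (L * t * s *_) (sum-map-concat weight rows m) ⟩
    L * t * s * sum (applyUpTo R m)                             ≡⟨ *-assoc (L * t) s _ ⟩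
    L * t * (s * sum (applyUpTo R m))                           ≤⟨ *-monoʳ-≤ (L * t) (columns R (λ j → weight (φ j 0)) m (λ j lt → row-sum s (φ j) n (λ i → φ-in j i lt) (ratio j))) ⟩
    L * t * ((1 + s) * sum (applyUpTo (λ j → weight (φ j 0)) m)) ≡⟨ lem L t (1 + s) (sum (applyUpTo (λ j → weight (φ j 0)) m)) ⟩
    (1 + s) * (L * (t * sum (applyUpTo (λ j → weight (φ j 0)) m))) ≤⟨ *-monoʳ-≤ (1 + s) (*-monoʳ-≤ L
      (geometric-sum t (λ j → weight (φ j 0)) m (λ j lt → weight-ratio (1 + t) (φ₀-in j (<-trans (n<1+n j) lt)) (φ₀-in (suc j) lt) (ratio′ j)))) ⟩
    (1 + s) * (L * ((1 + t) * weight (φ 0 0)))                  ≤⟨ *-monoʳ-≤ (1 + s) (head-mass (1 + t) L φ₀₀-in L≤) ⟩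
    (1 + s) * ((1 + t) * K)                                     ≡⟨ *-assoc (1 + s) (1 + t) K ⟨
    (1 + s) * (1 + t) * K                                       ∎
    where
    open ≤-Reasoning
    rows = λ j → applyUpTo (φ j) n
    R = λ j → sum (map weight (rows j))
    lem : ∀ L t c S → L * t * (c * S) ≡ c * (L * (t * S))
    lem = solve-∀
    columns : ∀ (R h : ℕ → ℕ) m → (∀ j → j < m → s * R j ≤ (1 + s) * h j) → s * sum (applyUpTo R m) ≤ (1 + s) * sum (applyUpTo h m)
    columns R h zero _ = ≤-reflexive (trans (*-zeroʳ s) (sym (*-zeroʳ (1 + s))))
    columns R h (suc m) le = subst₂ _≤_ (sym (*-distribˡ-+ s (R 0) _)) (sym (*-distribˡ-+ (1 + s) (h 0) _))
      (+-mono-≤ (le 0 z<s) (columns (R ∘ suc) (h ∘ suc) m (λ j lt → le (suc j) (s<s lt))))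

  -- The inequality Π (1 - 1/Q) ≥ 1 - Σ 1/Q, multiplied by `K` and by the product of all Q.
  weierstrass : ∀ xs → All InRange xs →
    K * product (map Q xs) ≤ K * product (map (val q) xs) + sum (map weight xs) * product (map Q xs)
  weierstrass [] [] = ≤-reflexive (sym (+-identityʳ _))
  weierstrass (x ∷ xs) (x-in ∷ xs-in) = begin
    K * (Q x * R)                                ≡⟨ cong (λ z → K * (z * R)) Qx≡ ⟩
    K * ((1 + v) * R)                            ≡⟨ l₁ K v R ⟩
    v * (K * R) + K * R                          ≤⟨ +-monoˡ-≤ (K * R) (*-monoʳ-≤ v (weierstrass xs xs-in)) ⟩
    v * (K * V + S * R) + K * R                  ≡⟨ cong (λ z → v * (K * V + S * R) + z * R) (sym (weight-Q x-in)) ⟩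
    v * (K * V + S * R) + weight x * Q x * R     ≡⟨ l₂ v K V S R (weight x) (Q x) ⟩
    K * (v * V) + (weight x * (Q x * R) + S * (v * R)) ≤⟨ +-monoʳ-≤ (K * (v * V)) (+-monoʳ-≤ (weight x * (Q x * R)) (*-monoʳ-≤ S (*-monoˡ-≤ R (m∸n≤m (Q x) 1)))) ⟩
    K * (v * V) + (weight x * (Q x * R) + S * (Q x * R)) ≡⟨ cong (K * (v * V) +_) (*-distribʳ-+ (Q x * R) (weight x) S) ⟨
    K * (v * V) + (weight x + S) * (Q x * R)     ∎
    where
    open ≤-Reasoning
    v = val q x
    R = product (map Q xs)
    V = product (map (val q) xs)
    S = sum (map weight xs)
    Qx≡ : Q x ≡ 1 + v
    Qx≡ = sym (m+[n∸m]≡n (Q>0 x))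
    l₁ : ∀ K v R → K * ((1 + v) * R) ≡ v * (K * R) + K * R
    l₁ = solve-∀
    l₂ : ∀ v K V S R w Q → v * (K * V + S * R) + w * Q * R ≡ K * (v * V) + (w * (Q * R) + S * (v * R))
    l₂ = solve-∀

  mass⇒density : ∀ {xs U u v} → All InRange xs → Unique xs → (∀ {x} → x ∈ xs → x ∈ U) → Mass≤ U u v →
    u * product (map Q xs) ≤ u * product (map (val q) xs) + v * product (map Q xs)
  mass⇒density {xs} {U} {u} {v} xs-in uniq sub (mass≤ small) = *-cancelˡ-≤ K {{>-nonZero (Q>0 (A , B))}} (begin
    K * (u * R)                 ≡⟨ l₁ K u R ⟩
    u * (K * R)                 ≤⟨ *-monoʳ-≤ u (weierstrass xs xs-in) ⟩
    u * (K * V + S * R)         ≡⟨ l₂ u K V S R ⟩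
    K * (u * V) + u * S * R     ≤⟨ +-monoʳ-≤ (K * (u * V)) (*-monoˡ-≤ R (≤-trans (*-monoʳ-≤ u (sum-⊆ weight uniq sub)) small)) ⟩
    K * (u * V) + v * K * R     ≡⟨ l₃ K u V v R ⟩
    K * (u * V + v * R)         ∎)
    where
    open ≤-Reasoning
    R = product (map Q xs)
    V = product (map (val q) xs)
    S = sum (map weight xs)
    l₁ : ∀ K u R → K * (u * R) ≡ u * (K * R)
    l₁ = solve-∀
    l₂ : ∀ u K V S R → u * (K * V + S * R) ≡ K * (u * V) + u * S * R
    l₂ = solve-∀
    l₃ : ∀ K u V v R → K * (u * V) + v * K * R ≡ K * (u * V + v * R)
    l₃ = solve-∀

-- The number 1 + s is a known lower bound of q and replaces q in all bounds, so that they become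
-- numerals while q stays unknown.
module Size (q f g : ℕ) (s : ℕ) (s<q : s < q) where

  -- The lists below overshoot f and g; these ranges are wide enough for every index and starting
  -- exponent `k` ≤ 3.
  open Weights q (3 + 2 * f) (3 + 2 * g) (≤-<-trans z≤n s<q) public

  ρ : ℕ
  ρ = s + s * (1 + s)

  -- The parameter `k` is the least exponent of q allowed. Raising it leaves out pairs already split
  -- off or known to be absent, such as (1 , 1) and (2 , 1).
  U₁ U₂ : ℕ → List (ℕ × ℕ)
  U₁ k = applyUpTo (λ i → 1 , k + i) (1 + g)
  U₂ k = applyUpTo (λ i → 2 , k + 2 * i) (1 + g)

  U₃ : List (ℕ × ℕ)
  U₃ = concat (applyUpTo (λ j → applyUpTo (λ i → 3 + 2 * i , 2 * j) (1 + f)) (1 + g))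

  private
    r^≤q^ : ∀ k → (1 + s) ^ k ≤ q ^ k
    r^≤q^ k = ^-monoˡ-≤ k s<q

    k+i≤ : ∀ {k i} → k ≤ 3 → i < 1 + g → k + i ≤ 3 + 2 * g
    k+i≤ k≤3 (s≤s i≤g) = +-mono-≤ k≤3 (≤-trans i≤g (m≤m+n g _))

    k+2i≤ : ∀ {k i n} → k ≤ 3 → i < 1 + n → k + 2 * i ≤ 3 + 2 * n
    k+2i≤ k≤3 (s≤s i≤n) = +-mono-≤ k≤3 (*-monoʳ-≤ 2 i≤n)

    2i≤ : ∀ {i n} → i < 1 + n → 2 * i ≤ 3 + 2 * n
    2i≤ = k+2i≤ {0} z≤n

    -- (1 + s)² is 1 + ρ by computation.
    square-ratio : ∀ c a b → (1 + ρ) * (c ^ a * q ^ b) ≤ c ^ a * q ^ (2 + b)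
    square-ratio c a b = ≤-trans (*-monoˡ-≤ (c ^ a * q ^ b) (*-mono-≤ s<q s<q)) (≤-reflexive (lem q (c ^ a) (q ^ b)))
      where
      lem : ∀ q x y → q * q * (x * y) ≡ x * (q * (q * y))
      lem = solve-∀

    k+2[1+i] : ∀ k i → 2 + (k + 2 * i) ≡ k + 2 * suc i
    k+2[1+i] = solve-∀

  mass-U₁ : ∀ k → k ≤ 3 → Mass≤ (U₁ k) (2 * (1 + s) ^ k * s) (1 + s)
  mass-U₁ k k≤3 = geometric-mass s (2 * (1 + s) ^ k) (λ i → 1 , k + i) (1 + g)
    (s≤s z≤n , k+i≤ {k} k≤3 z<s) (λ i i< → s≤s z≤n , k+i≤ {k} k≤3 i<)
    (λ i → ≤-trans (*-monoˡ-≤ (2 * q ^ (k + i)) s<q) (≤-reflexive (trans (lem q (q ^ (k + i))) (cong (λ e → 2 * q ^ e) (sym (+-suc k i))))))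
    (*-monoʳ-≤ 2 (≤-trans (r^≤q^ k) (≤-reflexive (cong (q ^_) (sym (+-identityʳ k))))))
    where
    lem : ∀ q x → q * (2 * x) ≡ 2 * (q * x)
    lem = solve-∀

  mass-U₂ : ∀ k → k ≤ 3 → Mass≤ (U₂ k) (4 * (1 + s) ^ k * ρ) (1 + ρ)
  mass-U₂ k k≤3 = geometric-mass ρ (4 * (1 + s) ^ k) (λ i → 2 , k + 2 * i) (1 + g)
    (s≤s (s≤s z≤n) , k+2i≤ {k} {0} {g} k≤3 z<s) (λ i i< → s≤s (s≤s z≤n) , k+2i≤ {k} k≤3 i<)
    (λ i → ≤-trans (square-ratio 2 2 (k + 2 * i)) (≤-reflexive (cong (λ e → 2 ^ 2 * q ^ e) (k+2[1+i] k i))))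
    (*-monoʳ-≤ 4 (≤-trans (r^≤q^ k) (≤-reflexive (cong (q ^_) (sym (+-identityʳ k))))))

  mass-U₃ : Mass≤ U₃ (8 * ρ * 3) (4 * (1 + ρ))
  -- Along a row the ratio is 1/4, between rows at most 1/(1 + `ρ`), and the leading term is 1/8.
  mass-U₃ = double-geometric-mass 3 ρ 8 (λ j i → 3 + 2 * i , 2 * j) (1 + g) (1 + f)
    (s≤s (s≤s (s≤s z≤n)) , z≤n)
    (λ j i j< i< → k+2i≤ {3} ≤-refl i< , 2i≤ j<)
    (λ j j< → s≤s (s≤s (s≤s z≤n)) , 2i≤ j<)
    (λ j i → ≤-reflexive (trans (lem (2 ^ (3 + 2 * i)) (q ^ (2 * j))) (cong (λ e → 2 ^ e * q ^ (2 * j)) (k+2[1+i] 3 i))))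
    (λ j → ≤-trans (square-ratio 2 3 (2 * j)) (≤-reflexive (cong (λ e → 2 ^ 3 * q ^ e) (k+2[1+i] 0 j))))
    ≤-refl
    where
    lem : ∀ x y → 4 * (x * y) ≡ 2 * (2 * x) * y
    lem = solve-∀

  one∈U₁ : ∀ k i → k + i ≤ g → (1 , k + i) ∈ U₁ k
  one∈U₁ k i le = ∈-applyUpTo⁺ (λ i → 1 , k + i) (s≤s (≤-trans (m≤n+m i k) le))

  two∈U₂ : ∀ k i → k + 2 * i ≤ g → (2 , k + 2 * i) ∈ U₂ k
  two∈U₂ k i le = ∈-applyUpTo⁺ (λ i → 2 , k + 2 * i) (s≤s (≤-trans (m≤m+n i _) (≤-trans (m≤n+m (2 * i) k) le)))

  high∈U₃ : ∀ i j → 3 + 2 * i ≤ f → 2 * j ≤ g → (3 + 2 * i , 2 * j) ∈ U₃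
  high∈U₃ i j le le′ = ∈-concat⁺′ (∈-applyUpTo⁺ (λ i → 3 + 2 * i , 2 * j) (s≤s (≤-trans (m≤m+n i _) (≤-trans (m≤n+m (2 * i) 3) le))))
    (∈-applyUpTo⁺ (λ j → applyUpTo (λ i → 3 + 2 * i , 2 * j) (1 + f)) (s≤s (≤-trans (m≤m+n j _) le′)))

-- N = n₀ V and σ*(N) = m₀ R with V/R ≥ 1 - v/u, whereas 2N/σ*(N) = (1 + 1/X)(1 + 1/Y).
density-bound : ∀ {X Y V R} X₀ Y₀ n₀ m₀ u v → X₀ ≤ X → Y₀ ≤ Y → 0 < R →
  2 * (n₀ * V) ≡ (X + 1) * (Y + 1) → m₀ * R ≡ X * Y → u * R ≤ u * V + v * R →
  2 * n₀ * X₀ * Y₀ * u ≤ u * m₀ * (X₀ + 1) * (Y₀ + 1) + 2 * n₀ * X₀ * Y₀ * v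
density-bound {X} {Y} {V} {R} X₀ Y₀ n₀ m₀ u v X₀≤X Y₀≤Y 0<R 2N σN dense =
  *-cancelʳ-≤ _ _ R {{>-nonZero 0<R}} (begin
    2 * n₀ * X₀ * Y₀ * u * R                              ≡⟨ *-assoc (2 * n₀ * X₀ * Y₀) u R ⟩
    2 * n₀ * X₀ * Y₀ * (u * R)                            ≤⟨ *-monoʳ-≤ (2 * n₀ * X₀ * Y₀) dense ⟩
    2 * n₀ * X₀ * Y₀ * (u * V + v * R)                    ≡⟨ l₁ n₀ X₀ Y₀ u V v R ⟩
    u * X₀ * Y₀ * (2 * (n₀ * V)) + M * R                  ≡⟨ cong (λ z → u * X₀ * Y₀ * z + M * R) 2N ⟩
    u * X₀ * Y₀ * ((X + 1) * (Y + 1)) + M * R             ≡⟨ cong (_+ M * R) (l₂ u X₀ Y₀ X Y) ⟩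
    u * ((X₀ * X + X₀) * (Y₀ * Y + Y₀)) + M * R           ≤⟨ +-monoˡ-≤ (M * R) (*-monoʳ-≤ u (*-mono-≤ (+-monoʳ-≤ (X₀ * X) X₀≤X) (+-monoʳ-≤ (Y₀ * Y) Y₀≤Y))) ⟩
    u * ((X₀ * X + X) * (Y₀ * Y + Y)) + M * R             ≡⟨ cong (_+ M * R) (l₃ u X₀ Y₀ X Y) ⟩
    u * (X₀ + 1) * (Y₀ + 1) * (X * Y) + M * R             ≡⟨ cong (λ z → u * (X₀ + 1) * (Y₀ + 1) * z + M * R) (sym σN) ⟩
    u * (X₀ + 1) * (Y₀ + 1) * (m₀ * R) + M * R            ≡⟨ l₄ u X₀ Y₀ m₀ R M ⟩
    (u * m₀ * (X₀ + 1) * (Y₀ + 1) + M) * R                ∎)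
  where
  open ≤-Reasoning
  M = 2 * n₀ * X₀ * Y₀ * v
  l₁ : ∀ n₀ X₀ Y₀ u V v R → 2 * n₀ * X₀ * Y₀ * (u * V + v * R) ≡ u * X₀ * Y₀ * (2 * (n₀ * V)) + 2 * n₀ * X₀ * Y₀ * v * R
  l₁ = solve-∀
  l₂ : ∀ u X₀ Y₀ X Y → u * X₀ * Y₀ * ((X + 1) * (Y + 1)) ≡ u * ((X₀ * X + X₀) * (Y₀ * Y + Y₀))
  l₂ = solve-∀
  l₃ : ∀ u X₀ Y₀ X Y → u * ((X₀ * X + X) * (Y₀ * Y + Y)) ≡ u * (X₀ + 1) * (Y₀ + 1) * (X * Y)
  l₃ = solve-∀
  l₄ : ∀ u X₀ Y₀ m₀ R M → u * (X₀ + 1) * (Y₀ + 1) * (m₀ * R) + M * R ≡ (u * m₀ * (X₀ + 1) * (Y₀ + 1) + M) * R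
  l₄ = solve-∀

-- Exponent sums and removal of components.

two-adic-unique : ∀ a c {x y} → x % 2 ≡ 1 → y % 2 ≡ 1 → 2 ^ a * x ≡ 2 ^ c * y → a ≡ c × x ≡ y
two-adic-unique zero zero {x} {y} _ _ eq = refl , +-cancelʳ-≡ 0 x y eq
two-adic-unique zero (suc c) {x} {y} x-odd _ eq = contradiction
  (subst (2 ∣_) (trans (sym eq) (*-identityˡ x)) (∣m⇒∣m*n y (m∣m*n {2} (2 ^ c)))) (odd⇒2∤ x-odd)
two-adic-unique (suc a) zero {x} {y} _ y-odd eq = contradiction
  (subst (2 ∣_) (trans eq (*-identityˡ y)) (∣m⇒∣m*n x (m∣m*n {2} (2 ^ a)))) (odd⇒2∤ y-odd)
two-adic-unique (suc a) (suc c) {x} {y} x-odd y-odd eq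
  with refl , x≡y ← two-adic-unique a c x-odd y-odd
         (*-cancelˡ-≡ _ _ 2 (trans (sym (*-assoc 2 (2 ^ a) x)) (trans eq (*-assoc 2 (2 ^ c) y)))) = refl , x≡y

^-cancelˡ-≡ : ∀ q b d → 1 < q → q ^ b ≡ q ^ d → b ≡ d
^-cancelˡ-≡ q zero    d       1<q eq = sym (n^e≡1⇒e≡0 q d 1<q (sym eq))
^-cancelˡ-≡ q (suc b) zero    1<q eq = n^e≡1⇒e≡0 q (suc b) 1<q eq
^-cancelˡ-≡ q (suc b) (suc d) 1<q eq =
  cong suc (^-cancelˡ-≡ q b d 1<q (*-cancelˡ-≡ _ _ q {{>-nonZero (<-trans z<s 1<q)}} eq))

product-val+1-sum : ∀ q xs → product (map (val+1 q) xs) ≡ 2 ^ sum (map proj₁ xs) * q ^ sum (map proj₂ xs)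
product-val+1-sum q [] = refl
product-val+1-sum q ((a , b) ∷ xs) = trans (cong (2 ^ a * q ^ b *_) (product-val+1-sum q xs))
  (trans (lem (2 ^ a) (q ^ b) (2 ^ α) (q ^ β)) (sym (cong₂ _*_ (^-distribˡ-+-* 2 a α) (^-distribˡ-+-* q b β))))
  where
  α = sum (map proj₁ xs)
  β = sum (map proj₂ xs)
  lem : ∀ x y z t → x * y * (z * t) ≡ x * z * (y * t)
  lem = solve-∀

∈⇒≤sum : ∀ {A : Set} (h : A → ℕ) {x xs} → x ∈ xs → h x ≤ sum (map h xs)
∈⇒≤sum h (here refl)            = m≤m+n _ _
∈⇒≤sum h (there {x = y} x∈) = ≤-trans (∈⇒≤sum h x∈) (m≤n+m _ (h y))

-- The list ys holds what is left of the components of N after components of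
-- total value n₀, with σ*(n₀) = m₀ and exponent sums a₀ and b₀, have been removed.
record Remaining (N q f g n₀ m₀ a₀ b₀ : ℕ) (ys : List (ℕ × ℕ)) : Set where
  field
    N-odd    : N % 2 ≡ 1
    q-prime  : Prime q
    q-odd    : q % 2 ≡ 1
    0<f      : 0 < f
    0<g      : 0 < g
    2N       : 2 * N ≡ (2 ^ f + 1) * (q ^ g + 1)
    shapes   : All (λ (a , b) → Shape q f g a b) ys
    coprime  : AllPairs (λ x y → Coprime (val q x) (val q y)) ys
    unique   : Unique ys
    N≡       : n₀ * product (map (val q) ys) ≡ N
    σ*N≡     : m₀ * product (map (val+1 q) ys) ≡ 2 ^ f * q ^ g
    f≡       : a₀ + sum (map proj₁ ys) ≡ f
    g≡       : b₀ + sum (map proj₂ ys) ≡ g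

  1<q : 1 < q
  1<q = prime>1 q-prime

  a≤f : ∀ {y} → y ∈ ys → a₀ + proj₁ y ≤ f
  a≤f y∈ = subst (_ ≤_) f≡ (+-monoʳ-≤ a₀ (∈⇒≤sum proj₁ y∈))

  b≤g : ∀ {y} → y ∈ ys → b₀ + proj₂ y ≤ g
  b≤g y∈ = subst (_ ≤_) g≡ (+-monoʳ-≤ b₀ (∈⇒≤sum proj₂ y∈))

  -- Cleared of denominators, the last hypothesis says m₀/(2 n₀) · (1 + 2^-kf)(1 + (1 + s)^-kg) +
  -- v/u < 1, the opposite of `density-bound`. All callers supply numerals, so evaluation decides
  -- it.
  too-dense : ∀ s (s<q : s < q) kf kg → kf ≤ f → kg ≤ g → let open Size q f g s s<q in
    ∀ {U u v} → Mass≤ U u v → (∀ {y} → y ∈ ys → y ∈ U) →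
    u * m₀ * (2 ^ kf + 1) * ((1 + s) ^ kg + 1) + 2 * n₀ * 2 ^ kf * (1 + s) ^ kg * v < 2 * n₀ * 2 ^ kf * (1 + s) ^ kg * u → ⊥
  too-dense s s<q kf kg kf≤f kg≤g {U} {u} {v} mass cover lt = <⇒≱ lt
    (density-bound (2 ^ kf) ((1 + s) ^ kg) n₀ m₀ u v (^-monoʳ-≤ 2 kf≤f)
      (≤-trans (^-monoˡ-≤ kg s<q) (^-monoʳ-≤ q {{>-nonZero (<-trans z<s 1<q)}} kg≤g))
      (product>0 ys) (trans (cong (2 *_) N≡) 2N) σ*N≡
      (mass⇒density {U = U} {u} {v} (All.tabulate in-range) unique cover mass))
    where
    open Size q f g s s<q
    product>0 : ∀ xs → 0 < product (map (val+1 q) xs)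
    product>0 []       = z<s
    product>0 (x ∷ xs) = *-mono-≤ (Q>0 x) (product>0 xs)
    in-range : ∀ {y} → y ∈ ys → InRange y
    in-range y∈ = ≤-trans (≤-trans (m≤n+m _ a₀) (a≤f y∈)) (≤-trans (m≤n*m f 2) (m≤n+m (2 * f) 3)) ,
                  ≤-trans (≤-trans (m≤n+m _ b₀) (b≤g y∈)) (≤-trans (m≤n*m g 2) (m≤n+m (2 * g) 3))

  -- The coprimality returned here says, once 3 is removed, that no remaining component is divisible
  -- by 3; the congruences modulo 3 and 9 rest on it.
  remove : ∀ {x} → x ∈ ys → ∃ λ zs →
    Remaining N q f g (n₀ * val q x) (m₀ * val+1 q x) (a₀ + proj₁ x) (b₀ + proj₂ x) zs ×
    x ∉ zs × (∀ {z} → z ∈ zs → z ∈ ys × Coprime (val q x) (val q z))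
  remove {x} x∈ with us , vs , refl ← ∈-∃++ x∈ = us ++ vs , rest (All-resp-↭ perm shapes)
      (PermS.AllPairs-resp-↭ (setoid _) Coprime.sym ((λ { refl cop → cop }) , λ { refl cop → cop }) (↭⇒↭ₛ perm) coprime)
      (PermS.Unique-resp-↭ (setoid _) (↭⇒↭ₛ perm) unique)
    where
    zs = us ++ vs
    perm : us ++ x ∷ vs ↭ x ∷ zs
    perm = shift x us vs
    rest : All (λ (a , b) → Shape q f g a b) (x ∷ zs) → AllPairs (λ x y → Coprime (val q x) (val q y)) (x ∷ zs) → Unique (x ∷ zs) →
      Remaining N q f g (n₀ * val q x) (m₀ * val+1 q x) (a₀ + proj₁ x) (b₀ + proj₂ x) zs ×
      x ∉ zs × (∀ {z} → z ∈ zs → z ∈ us ++ x ∷ vs × Coprime (val q x) (val q z))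
    rest (_ ∷ sh) (cop ∷ cops) (x≢ ∷ uniq) = record
      { N-odd = N-odd ; q-prime = q-prime ; q-odd = q-odd ; 0<f = 0<f ; 0<g = 0<g ; 2N = 2N
      ; shapes = sh ; coprime = cops ; unique = uniq
      ; N≡   = trans (*-assoc n₀ (val q x) _) (trans (cong (n₀ *_) (sym (product-↭ (Perm.map⁺ (val q) perm)))) N≡)
      ; σ*N≡ = trans (*-assoc m₀ (val+1 q x) _) (trans (cong (m₀ *_) (sym (product-↭ (Perm.map⁺ (val+1 q) perm)))) σ*N≡)
      ; f≡   = trans (+-assoc a₀ (proj₁ x) _) (trans (cong (a₀ +_) (sym (sum-↭ (Perm.map⁺ proj₁ perm)))) f≡)
      ; g≡   = trans (+-assoc b₀ (proj₂ x) _) (trans (cong (b₀ +_) (sym (sum-↭ (Perm.map⁺ proj₂ perm)))) g≡)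
      } , (λ x∈zs → All.lookup x≢ x∈zs refl) , λ z∈ → ∈-resp-↭ (↭-sym perm) (there z∈) , All.lookup cop z∈

perfect⇒remaining : ∀ {N} → N % 2 ≡ 1 → σ* (σ* N) ≡ 2 * N → ∃ λ q → ∃₂ λ f g → ∃ λ xs → Remaining N q f g 1 1 0 0 xs
perfect⇒remaining {N} N-odd perfect = q , suc f , suc g , exponents , record
  { N-odd = N-odd ; q-prime = q-prime ; q-odd = q-odd ; 0<f = z<s ; 0<g = z<s ; 2N = 2N
  ; shapes = All.map (λ (C , p∣N) → classify (prime>1 q-prime) q-odd C (subst (Component.p C ∣_) 2N (∣n⇒∣m*n 2 p∣N))) components
  ; coprime = coprime
  ; unique = distinct exponents coprime (All.map (λ (C , _) → subst (1 <_) (sym (component-val C)) (p^1+e>1 C)) components)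
  ; N≡ = trans (*-identityˡ _) product-val
  ; σ*N≡ = trans (*-identityˡ _) (trans product-val+1 σ*-N)
  ; f≡ = proj₁ exponent-sums
  ; g≡ = ^-cancelˡ-≡ q _ _ (prime>1 q-prime) (proj₂ exponent-sums)
  }
  where
  open TwoPrimes (σ*-two-primes {N} N-odd perfect)
  only : ∀ {r} → Prime r → r ∣ σ* N → r ≡ 2 ⊎ r ≡ q
  only {r} pr r∣ with euclidsLemma (2 ^ suc f) (q ^ suc g) pr (subst (r ∣_) σ*-N r∣)
  ... | inj₁ r∣2^ = inj₁ (prime∣prime pr prime[2] (prime∣^ 2 (suc f) pr r∣2^))
  ... | inj₂ r∣q^ = inj₂ (prime∣prime pr q-prime (prime∣^ q (suc g) pr r∣q^))
  0<N : 0 < N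
  0<N = n≢0⇒n>0 λ { refl → contradiction N-odd λ () }
  open Components (decompose q-prime N 0<N N-odd only)
  distinct : ∀ xs → AllPairs (λ x y → Coprime (val q x) (val q y)) xs → All (λ x → 1 < val q x) xs → Unique xs
  distinct [] [] [] = []
  distinct (x ∷ xs) (cop ∷ cops) (1<x ∷ 1<xs) =
    All.map (λ { cop refl → <-irrefl (sym (cop (∣-refl , ∣-refl))) 1<x }) cop ∷ distinct xs cops 1<xs
  exponent-sums : sum (map proj₁ exponents) ≡ suc f × q ^ sum (map proj₂ exponents) ≡ q ^ suc g
  exponent-sums = two-adic-unique _ (suc f) (odd-^ q (sum (map proj₂ exponents)) q-odd) (odd-^ q (suc g) q-odd)
    (trans (sym (product-val+1-sum q exponents)) (trans product-val+1 σ*-N))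

-- Congruences, coverings by the lists, and the small cases.

odd-power-% : ∀ k n {r} t → n % (2 + k) ≡ r → (r * r) % (2 + k) ≡ 1 → n ^ (1 + 2 * t) % (2 + k) ≡ r
odd-power-% k n {r} t n≡r r²≡1 = begin
  (n * n ^ (2 * t)) % m             ≡⟨ %-distribˡ-* n (n ^ (2 * t)) m ⟩
  ((n % m) * (n ^ (2 * t) % m)) % m ≡⟨ cong (λ x → ((n % m) * x) % m) even-power ⟩
  ((n % m) * 1) % m                 ≡⟨ cong (_% m) (*-identityʳ (n % m)) ⟩
  (n % m) % m                       ≡⟨ m%n%n≡m%n n m ⟩
  n % m                             ≡⟨ n≡r ⟩
  r                                 ∎
  where
  open ≡-Reasoning
  m = 2 + k
  even-power : n ^ (2 * t) % m ≡ 1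
  even-power = trans (cong (_% m) (sym (^-*-assoc n 2 t))) (^-%≡1 (n ^ 2) t (trans (cong (λ x → (n * x) % m) (*-identityʳ n))
    (trans (%-distribˡ-* n n m) (trans (cong (λ x → (x * x) % m) n≡r) r²≡1))))

odd-power+1 : ∀ k n t → n % (2 + k) ≡ 1 + k → ((1 + k) * (1 + k)) % (2 + k) ≡ 1 → 2 + k ∣ n ^ (1 + 2 * t) + 1
odd-power+1 k n t n≡-1 sq = m%n≡0⇒n∣m _ (2 + k) (trans (%-distribˡ-+ (n ^ (1 + 2 * t)) 1 (2 + k))
  (trans (cong (λ x → (x + 1) % (2 + k)) (odd-power-% k n t n≡-1 sq)) (trans (cong (_% (2 + k)) (+-comm (1 + k) 1)) (n%n≡0 (2 + k)))))

≡1mod3⇒3∣pred : ∀ n → n % 3 ≡ 1 → 3 ∣ n ∸ 1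
≡1mod3⇒3∣pred n eq = divides (n / 3) (cong (_∸ 1) (trans (m≡m%n+[m/n]*n n 3) (cong (_+ n / 3 * 3) eq)))

prime[3] : Prime 3
prime[3] = from-yes (prime? 3)

∤product : ∀ {A : Set} (h : A → ℕ) {r} → Prime r → ∀ xs → (∀ {x} → x ∈ xs → r ∤ h x) → r ∤ product (map h xs)
∤product h pr []       _ r∣ = prime∤1 pr r∣
∤product h pr (x ∷ xs) ∤ r∣ with euclidsLemma (h x) _ pr r∣
... | inj₁ r∣hx = ∤ (here refl) r∣hx
... | inj₂ r∣xs = ∤product h pr xs (∤ ∘ there) r∣xs

¬Odd-even : ∀ t → ¬ Odd (2 * t)
¬Odd-even t (u , eq) = even≢odd t u eq

odd-prime-cases : ∀ {q} → 1 < q → q % 2 ≡ 1 → q ≡ 3 ⊎ 5 ≤ q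
odd-prime-cases {q} 1<q q-odd with q ≟ 3 | q <? 5
... | yes eq | _        = inj₁ eq
... | no _   | no q≮5   = inj₂ (≮⇒≥ q≮5)
... | no q≢3 | yes q<5  = contradiction (1<q , q-odd , q≢3)
  (from-yes (allUpTo? (λ q → ¬? ((1 <? q) ×-dec ((q % 2 ≟ 1) ×-dec ¬? (q ≟ 3)))) 5) q<5)

1mod4-cases : ∀ {q} → 1 < q → q % 4 ≡ 1 → q ≡ 5 ⊎ 9 ≤ q
1mod4-cases {q} 1<q q≡1 with q ≟ 5 | q <? 9
... | yes eq | _        = inj₁ eq
... | no _   | no q≮9   = inj₂ (≮⇒≥ q≮9)
... | no q≢5 | yes q<9  = contradiction (1<q , q≡1 , q≢5)
  (from-yes (allUpTo? (λ q → ¬? ((1 <? q) ×-dec ((q % 4 ≟ 1) ×-dec ¬? (q ≟ 5)))) 9) q<9)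

1mod12-bound : ∀ {q} → 1 < q → q % 4 ≡ 1 → q % 3 ≡ 1 → 13 ≤ q
1mod12-bound {q} 1<q q≡1 q≡1′ with q <? 13
... | no q≮13  = ≮⇒≥ q≮13
... | yes q<13 = contradiction (1<q , q≡1 , q≡1′)
  (from-yes (allUpTo? (λ q → ¬? ((1 <? q) ×-dec ((q % 4 ≟ 1) ×-dec (q % 3 ≟ 1)))) 13) q<13)

shape⇒0<a : ∀ {q f g a b} → Shape q f g a b → 0 < a
shape⇒0<a (one _)        = z<s
shape⇒0<a (three _)      = z<s
shape⇒0<a (two _ _)      = z<s
shape⇒0<a (high _ _ _ _) = z<s

module _ {N q f g n₀ m₀ a₀ b₀ ys} (R : Remaining N q f g n₀ m₀ a₀ b₀ ys) where
  open Remaining R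

  module _ (s : ℕ) (s<q : s < q) where
    open Size q f g s s<q

    private
      b≤ : ∀ {y} → y ∈ ys → proj₂ y ≤ g
      b≤ y∈ = m+n≤o⇒n≤o b₀ (b≤g y∈)
      a≤ : ∀ {y} → y ∈ ys → proj₁ y ≤ f
      a≤ y∈ = m+n≤o⇒n≤o a₀ (a≤f y∈)

    cover-U₁ : ¬ Odd g → ¬ Odd f → ∀ {y} → y ∈ ys → y ∈ U₁ 1
    cover-U₁ g-even f-even y∈ with All.lookup shapes y∈ | b≤ y∈
    ... | one b          | le = one∈U₁ 1 b le
    ... | three (inj₁ o) | _  = contradiction o f-even
    ... | three (inj₂ o) | _  = contradiction o g-even
    ... | two o _        | _  = contradiction o f-even
    ... | high o _ _ _   | _  = contradiction o g-even

    cover-U₁₂ : ¬ Odd g → (2 , 0) ∉ ys → ∀ {y} → y ∈ ys → y ∈ U₁ 1 ++ U₂ 1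
    cover-U₁₂ g-even no-3 y∈ with All.lookup shapes y∈ | b≤ y∈
    ... | one b        | le = ∈-++⁺ˡ (one∈U₁ 1 b le)
    ... | three _      | _  = contradiction y∈ no-3
    ... | two _ t      | le = ∈-++⁺ʳ (U₁ 1) (two∈U₂ 1 t le)
    ... | high o _ _ _ | _  = contradiction o g-even

    cover-U₁₂-no-1,1 : ¬ Odd g → (2 , 0) ∉ ys → (1 , 1) ∉ ys → ∀ {y} → y ∈ ys → y ∈ U₁ 2 ++ U₂ 1
    cover-U₁₂-no-1,1 g-even no-3 no-11 y∈ with All.lookup shapes y∈ | b≤ y∈
    ... | one zero     | le = contradiction y∈ no-11
    ... | one (suc b)  | le = ∈-++⁺ˡ (one∈U₁ 2 b le)
    ... | three _      | _  = contradiction y∈ no-3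
    ... | two _ t      | le = ∈-++⁺ʳ (U₁ 2) (two∈U₂ 1 t le)
    ... | high o _ _ _ | _  = contradiction o g-even

    cover-U₁₂-no-2,1 : ¬ Odd g → (2 , 0) ∉ ys → (1 , 1) ∉ ys → (2 , 1) ∉ ys → ∀ {y} → y ∈ ys → y ∈ U₁ 2 ++ U₂ 3
    cover-U₁₂-no-2,1 g-even no-3 no-11 no-21 y∈ with All.lookup shapes y∈ | b≤ y∈
    ... | one zero      | le = contradiction y∈ no-11
    ... | one (suc b)   | le = ∈-++⁺ˡ (one∈U₁ 2 b le)
    ... | three _       | _  = contradiction y∈ no-3
    ... | two _ zero    | _  = contradiction y∈ no-21
    ... | two _ (suc t) | le = ∈-++⁺ʳ (U₁ 2) (subst (λ e → (2 , e) ∈ U₂ 3) (lem t) (two∈U₂ 3 t (subst (_≤ g) (sym (lem t)) le)))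
      where
      lem : ∀ t → 3 + 2 * t ≡ 1 + 2 * suc t
      lem = solve-∀
    ... | high o _ _ _  | _  = contradiction o g-even

    cover-U₁₂₃ : (2 , 0) ∉ ys → ∀ {y} → y ∈ ys → y ∈ (U₁ 1 ++ U₂ 1) ++ U₃
    cover-U₁₂₃ no-3 y∈ with All.lookup shapes y∈ | b≤ y∈ | a≤ y∈
    ... | one b        | le | _   = ∈-++⁺ˡ (∈-++⁺ˡ (one∈U₁ 1 b le))
    ... | three _      | _  | _   = contradiction y∈ no-3
    ... | two _ t      | le | _   = ∈-++⁺ˡ (∈-++⁺ʳ (U₁ 1) (two∈U₂ 1 t le))
    ... | high _ _ i j | le | le′ = ∈-++⁺ʳ (U₁ 1 ++ U₂ 1) (high∈U₃ i j le′ le)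

    cover-U₁₃ : (2 , 0) ∉ ys → (∀ t → (2 , 1 + 2 * t) ∉ ys) → ∀ {y} → y ∈ ys → y ∈ U₁ 1 ++ U₃
    cover-U₁₃ no-3 no-two y∈ with All.lookup shapes y∈ | b≤ y∈ | a≤ y∈
    ... | one b        | le | _   = ∈-++⁺ˡ (one∈U₁ 1 b le)
    ... | three _      | _  | _   = contradiction y∈ no-3
    ... | two _ t      | le | _   = contradiction y∈ (no-two t)
    ... | high _ _ i j | le | le′ = ∈-++⁺ʳ (U₁ 1) (high∈U₃ i j le′ le)

  -- If q ≡ 3 modulo 4, odd g makes 4 divide q^g + 1 and so 2N.
  g-odd⇒q≡1mod4 : Odd g → q % 4 ≡ 1
  g-odd⇒q≡1mod4 (t , refl) = check (m%n<n q 4) (trans (m∣n⇒o%n%m≡o%m 2 4 q (divides 2 refl)) q-odd) λ q≡3 →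
    odd⇒2∤ N-odd (*-cancelˡ-∣ {2} {N} 2 (subst (4 ∣_) (sym 2N) (∣n⇒∣m*n (2 ^ f + 1) (odd-power+1 2 q t q≡3 refl))))
    where
    check : ∀ {r} → r < 4 → r % 2 ≡ 1 → r ≢ 3 → r ≡ 1
    check = from-yes (allUpTo? (λ r → (r % 2 ≟ 1) →-dec (¬? (r ≟ 3) →-dec (r ≟ 1))) 4)

-- The positive exponents a sum to 1, so there is a single component N = 2Y - 1 with Y = q^g. Then
-- 2(2Y - 1) = 3(Y + 1), that is Y = 5.
f≡1⇒N≡9 : ∀ {N q g xs} → Remaining N q 1 g 1 1 0 0 xs → N ≡ 9
f≡1⇒N≡9 {xs = []} R = contradiction (Remaining.f≡ R) λ ()
f≡1⇒N≡9 {xs = x ∷ y ∷ _} R with Remaining.shapes R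
... | sx ∷ sy ∷ _ = contradiction (Remaining.f≡ R) (>⇒≢ (+-mono-≤ (shape⇒0<a sx) (≤-trans (shape⇒0<a sy) (m≤m+n _ _))))
f≡1⇒N≡9 {xs = x ∷ []} R with Remaining.shapes R | Remaining.f≡ R
... | three _ ∷ []      | ()
... | two _ _ ∷ []      | ()
... | high _ _ _ _ ∷ [] | ()
f≡1⇒N≡9 {N} {q} {g} {x ∷ []} R | one b ∷ [] | _ = suc-injective (trans N+1 (cong (2 *_) Y≡5))
  where
  open Remaining R
  Y = q ^ suc b
  N+1 : suc N ≡ 2 * Y
  N+1 = trans (cong suc (trans (sym N≡) (trans (*-identityˡ _) (*-identityʳ _))))
              (m+[n∸m]≡n (>-nonZero⁻¹ (2 * Y) {{m*n≢0 2 Y {{_}} {{m^n≢0 q (suc b) {{>-nonZero (<-trans z<s 1<q)}}}}}}))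
  Y≡5 : Y ≡ 5
  Y≡5 = +-cancelˡ-≡ (3 * Y) Y 5 (begin
    3 * Y + Y           ≡⟨ l₁ Y ⟩
    2 * (2 * Y)         ≡⟨ cong (2 *_) (sym N+1) ⟩
    2 * suc N           ≡⟨ l₂ N ⟩
    2 * N + 2           ≡⟨ cong (_+ 2) 2N ⟩
    3 * (q ^ g + 1) + 2 ≡⟨ cong (λ e → 3 * (q ^ e + 1) + 2) (trans (sym g≡) (+-identityʳ (suc b))) ⟩
    3 * (Y + 1) + 2     ≡⟨ l₃ Y ⟩
    3 * Y + 5           ∎)
    where
    open ≡-Reasoning
    l₁ : ∀ Y → 3 * Y + Y ≡ 2 * (2 * Y)
    l₁ = solve-∀
    l₂ : ∀ N → 2 * suc N ≡ 2 * N + 2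
    l₂ = solve-∀
    l₃ : ∀ Y → 3 * (Y + 1) + 2 ≡ 3 * Y + 5
    l₃ = solve-∀

-- Here the only available primes for a ≥ 3 would divide q + 1 = 6.
¬q≡5,g≡1 : ∀ {N f xs} → Remaining N 5 f 1 1 1 0 0 xs → 2 ≤ f → (2 , 0) ∉ xs → ⊥
¬q≡5,g≡1 {N} {f} {xs} R 2≤f no-3 = go xs (λ y∈ → y∈) f≡ g≡
  where
  open Remaining R
  data Low : ℕ × ℕ → Set where
    one : ∀ b → Low (1 , suc b)
    two : Odd f → ∀ t → Low (2 , 1 + 2 * t)
  low : ∀ {y} → y ∈ xs → Low y
  low y∈ with All.lookup shapes y∈
  ... | one b   = one b
  ... | three _ = contradiction y∈ no-3
  ... | two o t = two o t
  ... | high _ (p , p≡7 , p∣6) _ _ = contradiction (∣⇒≤ p∣6) (<⇒≱ (subst (_≤ p) p≡7 (m%n≤m p 8)))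
  0<b : ∀ {y} → Low y → 0 < proj₂ y
  0<b (one _)   = z<s
  0<b (two _ _) = z<s
  go : ∀ ys → (∀ {y} → y ∈ ys → y ∈ xs) → sum (map proj₁ ys) ≡ f → sum (map proj₂ ys) ≡ 1 → ⊥
  go [] _ _ ()
  go (x ∷ y ∷ ys) sub _ g≡ = >⇒≢ (+-mono-≤ (0<b (low (sub (here refl)))) (≤-trans (0<b (low (sub (there (here refl))))) (m≤m+n _ _))) g≡
  go (x ∷ []) sub f≡ g≡ with low (sub (here refl))
  ... | one _   = >⇒≢ 2≤f (sym f≡)
  ... | two o _ = ¬Odd-even 1 (subst Odd (sym f≡) o)

not-odd-≥ : ∀ {n} k → ¬ Odd n → 1 + 2 * k ≤ n → 2 * suc k ≤ n
not-odd-≥ {n} k n-even le with parityView n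
... | even t = *-monoʳ-≤ 2 (*-cancelˡ-< 2 k t le)
... | odd t  = contradiction (t , refl) n-even

odd-≥ : ∀ {n} k → Odd n → 2 * k ≤ n → 1 + 2 * k ≤ n
odd-≥ k (t , refl) le = s≤s (*-monoʳ-≤ 2 (≤-pred (*-cancelˡ-< 2 k (suc t) (≤-trans (s≤s le) (≤-reflexive (lem t))))))
  where
  lem : ∀ t → suc (1 + 2 * t) ≡ 2 * suc t
  lem = solve-∀

Answer : ℕ → Set
Answer N = N ≡ 9 ⊎ N ≡ 165

-- The case in which 3 is a component.

module _ {N f g zs} (R : Remaining N 3 f g 3 4 2 0 zs) (g-even : ¬ Odd g) (no-3 : (2 , 0) ∉ zs) (5≤f : 5 ≤ f) (f-odd : Odd f) where

  private
    module R = Remaining R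

    2<3 : 2 < 3
    2<3 = ≤-refl

    open Size 3 f g 2 2<3

    2≤g : 2 ≤ g
    2≤g = not-odd-≥ 0 g-even R.0<g

    -- Once 3, 5 and 11 are absent from the list, every component has b ≥ 2; the removed 5 adds at
    -- least 1 more to g.
    big-b : ∀ {n₀ m₀ a₀ b₀ y ys} → Remaining N 3 f g n₀ m₀ a₀ (suc b₀) (y ∷ ys) → (2 , 0) ∉ y ∷ ys → (1 , 1) ∉ y ∷ ys → (2 , 1) ∉ y ∷ ys → 3 ≤ g
    big-b {b₀ = b₀} {y} R′ n₁ n₂ n₃ = ≤-trans (s≤s (≤-trans (2≤b (All.head R′.shapes) n₁ n₂ n₃) (m≤n+m (proj₂ y) b₀))) (R′.b≤g (here refl))
      where
      module R′ = Remaining R′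
      2≤b : ∀ {a b ys} → Shape 3 f g a b → (2 , 0) ∉ (a , b) ∷ ys → (1 , 1) ∉ (a , b) ∷ ys → (2 , 1) ∉ (a , b) ∷ ys → 2 ≤ b
      2≤b (one zero)    _ n _ = contradiction (here refl) n
      2≤b (one (suc b)) _ _ _ = s≤s (s≤s z≤n)
      2≤b (three _)     n _ _ = contradiction (here refl) n
      2≤b (two _ zero)  _ _ n = contradiction (here refl) n
      2≤b (two _ (suc t)) _ _ _ = s≤s (s≤s z≤n)
      2≤b (high o _ _ _) _ _ _ = contradiction o g-even

    -- Here 165 = 3 · 5 · 11 and 288 = 4 · 6 · 12; the exponents add up to 2 + 1 + 2 and 0 + 1 + 1.
    last-step : ∀ {ys} → Remaining N 3 f g 165 288 5 2 ys → (2 , 0) ∉ ys → (1 , 1) ∉ ys → (2 , 1) ∉ ys → Answer N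
    last-step {[]} R₃ _ _ _ = inj₂ (sym (Remaining.N≡ R₃))
    -- A further component pushes f above 5 and g to at least 3; parity raises these to 7 and 4.
    last-step {y ∷ ys} R₃ n₁ n₂ n₃ = ⊥-elim (Remaining.too-dense R₃ 2 2<3 7 4
      (odd-≥ 3 f-odd (≤-trans (+-monoʳ-≤ 5 (shape⇒0<a (All.head (Remaining.shapes R₃)))) (Remaining.a≤f R₃ (here refl))))
      (not-odd-≥ 1 g-even (big-b R₃ n₁ n₂ n₃))
      (mass-++ (mass-U₁ 2 (s≤s (s≤s z≤n))) (mass-U₂ 3 ≤-refl))
      (cover-U₁₂-no-2,1 R₃ 2 2<3 g-even n₁ n₂ n₃) (<ᵇ⇒< _ _ tt))

    with-5 : ∀ {ys} → Remaining N 3 f g 15 24 3 1 ys → (2 , 0) ∉ ys → (1 , 1) ∉ ys → Answer N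
    with-5 {ys} R₂ n₁ n₂ with (2 , 1) ∈? ys
    ... | yes 21∈ with _ , R₃ , n₃ , sub ← Remaining.remove R₂ 21∈ =
      last-step R₃ (n₁ ∘ proj₁ ∘ sub) (n₂ ∘ proj₁ ∘ sub) n₃
    -- The components 3 and 5 alone would give f = 3.
    with-5 {[]} R₂ _ _ | no _ = contradiction (subst (5 ≤_) (sym (Remaining.f≡ R₂)) 5≤f) (<⇒≱ (<ᵇ⇒< 3 5 tt))
    with-5 {y ∷ ys} R₂ n₁ n₂ | no n₃ = ⊥-elim (Remaining.too-dense R₂ 2 2<3 5 4 5≤f
      (not-odd-≥ 1 g-even (big-b R₂ n₁ n₂ n₃))
      (mass-++ (mass-U₁ 2 (s≤s (s≤s z≤n))) (mass-U₂ 3 ≤-refl))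
      (cover-U₁₂-no-2,1 R₂ 2 2<3 g-even n₁ n₂ n₃) (<ᵇ⇒< _ _ tt))

  three∈,q≡3 : Answer N
  three∈,q≡3 with (1 , 1) ∈? zs
  ... | yes 11∈ with _ , R₂ , n₂ , sub ← Remaining.remove R 11∈ = with-5 R₂ (no-3 ∘ proj₁ ∘ sub) n₂
  ... | no n₂ = ⊥-elim (R.too-dense 2 2<3 5 2 5≤f 2≤g
    (mass-++ (mass-U₁ 2 (s≤s (s≤s z≤n))) (mass-U₂ 1 (s≤s z≤n)))
    (cover-U₁₂-no-1,1 R 2 2<3 g-even no-3 n₂) (<ᵇ⇒< _ _ tt))

odd? : ∀ n → Dec (Odd n)
odd? n with parityView n
... | even t = no (¬Odd-even t)
... | odd t  = yes (t , refl)

module _ {N q f g zs} (R : Remaining N q f g 3 4 2 0 zs) (no-3 : (2 , 0) ∉ zs)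
         (coprime-3 : ∀ {z} → z ∈ zs → Coprime 3 (val q z)) where
  private
    module R = Remaining R

    3∤val : ∀ {z} → z ∈ zs → 3 ∤ val q z
    3∤val z∈ 3∣ = contradiction (coprime-3 z∈ (∣-refl , 3∣)) λ ()

    -- The factor 3 occurs exactly once in 2N, namely in the component split off.
    9∤ : 9 ∤ (2 ^ f + 1) * (q ^ g + 1)
    9∤ 9∣ = [ (λ 3∣2 → contradiction (∣⇒≤ 3∣2) (<⇒≱ ≤-refl)) , ∤product (val q) prime[3] zs 3∤val ]′ (euclidsLemma 2 V prime[3] 3∣2V)
      where
      V = product (map (val q) zs)
      lem : ∀ V → 2 * (3 * V) ≡ 3 * (2 * V)
      lem = solve-∀
      3∣2V : 3 ∣ 2 * V
      3∣2V = *-cancelˡ-∣ 3 (subst (9 ∣_) (trans (sym R.2N) (trans (cong (2 *_) (sym R.N≡)) (lem V))) 9∣)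

    -- The component 3 already uses exponent 2, so f ≠ 1; and f = 3 would put 2^3 + 1 = 9 into 2N.
    f≥5 : Odd f → 5 ≤ f
    f≥5 (zero , refl) = contradiction (subst (2 ≤_) R.f≡ (m≤m+n 2 _)) (<⇒≱ (s≤s ≤-refl))
    f≥5 (suc zero , refl) = contradiction (m∣m*n (q ^ g + 1)) 9∤
    f≥5 (suc (suc t) , refl) = s≤s (*-monoʳ-≤ 2 {2} {suc (suc t)} (s≤s (s≤s z≤n)))

    g-even-case : ¬ Odd g → Odd f → Answer N
    g-even-case g-even f-odd with odd-prime-cases R.1<q R.q-odd
    ... | inj₁ refl = three∈,q≡3 R g-even no-3 (f≥5 f-odd) f-odd
    ... | inj₂ 5≤q = ⊥-elim (R.too-dense 4 5≤q 5 2 (f≥5 f-odd) (not-odd-≥ 0 g-even R.0<g)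
      (mass-++ (mass-U₁ 1 (s≤s z≤n)) (mass-U₂ 1 (s≤s z≤n)))
      (cover-U₁₂ R 4 5≤q g-even no-3) (<ᵇ⇒< _ _ tt))
      where open Size q f g 4 5≤q

    -- Now 4 q^b - 1 is divisible by 3, so no (2 , odd) occurs and `U₂` drops out. As q^g + 1 ≡ 2
    -- modulo 3, the factor 3 of N must come from 2^f + 1, which makes f odd.
    q≡1mod3-case : Odd g → q % 3 ≡ 1 → ⊥
    q≡1mod3-case g-odd q≡1 = R.too-dense 12 13≤q 5 1 (f≥5 f-odd) R.0<g
      (mass-++ (mass-U₁ 1 (s≤s z≤n)) mass-U₃)
      (cover-U₁₃ R 12 13≤q no-3 (λ t two∈ → 3∤val two∈ (≡1mod3⇒3∣pred (4 * q ^ (1 + 2 * t)) (trans (%-distribˡ-* 4 (q ^ (1 + 2 * t)) 3)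
        (cong (λ x → (1 * x) % 3) (^-%≡1 q (1 + 2 * t) q≡1)))))) (<ᵇ⇒< _ _ tt)
      where
      13≤q = 1mod12-bound R.1<q (g-odd⇒q≡1mod4 R g-odd) q≡1
      open Size q f g 12 13≤q
      3∣2N : 3 ∣ (2 ^ f + 1) * (q ^ g + 1)
      3∣2N = subst (3 ∣_) R.2N (∣n⇒∣m*n 2 (subst (3 ∣_) R.N≡ (m∣m*n {3} (product (map (val q) zs)))))
      q^g+1≡2 : (q ^ g + 1) % 3 ≡ 2
      q^g+1≡2 = trans (%-distribˡ-+ (q ^ g) 1 3) (cong (λ x → (x + 1) % 3) (^-%≡1 q g q≡1))
      f-odd : Odd f
      f-odd with parityView f
      ... | odd t = t , refl
      ... | even t = contradiction (trans (sym (n∣m⇒m%n≡0 _ 3 3∣2N)) (trans (%-distribˡ-* (2 ^ (2 * t) + 1) (q ^ g + 1) 3)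
          (cong₂ (λ x y → (x * y) % 3) 2^f+1≡2 q^g+1≡2))) λ ()
        where
        2^f+1≡2 : (2 ^ (2 * t) + 1) % 3 ≡ 2
        2^f+1≡2 = trans (%-distribˡ-+ (2 ^ (2 * t)) 1 3) (cong (λ x → (x + 1) % 3)
          (trans (cong (_% 3) (sym (^-*-assoc 2 2 t))) (^-%≡1 4 t refl)))

    -- Since 3 ∣ q^g + 1, odd f would give 9 ∣ 2N. For even f only even exponents b remain, because
    -- 2 q^b - 1 is divisible by 3 for odd b; yet they sum to the odd g.
    q≡2mod3-case : Odd g → q % 3 ≡ 2 → ⊥
    q≡2mod3-case g-odd@(t , g≡1+2t) q≡2 = ¬Odd-even (proj₁ sum-b-even) (subst Odd (trans (sym R.g≡) (proj₂ sum-b-even)) g-odd)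
      where
      f-even : ¬ Odd f
      f-even (u , f≡1+2u) = 9∤ (*-pres-∣ (subst (λ f → 3 ∣ 2 ^ f + 1) (sym f≡1+2u) (odd-power+1 1 2 u refl refl))
                                          (subst (λ g → 3 ∣ q ^ g + 1) (sym g≡1+2t) (odd-power+1 1 q t q≡2 refl)))
      b-even : ∀ {z} → z ∈ zs → ∃ λ u → proj₂ z ≡ 2 * u
      b-even z∈ with All.lookup R.shapes z∈
      ... | three _      = contradiction z∈ no-3
      ... | two o _      = contradiction o f-even
      ... | high _ _ _ u = u , refl
      ... | one b with parityView b
      ...   | odd u  = suc u , sym (*-suc 2 u)
      ...   | even u = contradiction (≡1mod3⇒3∣pred (2 * q ^ (1 + 2 * u)) (trans (%-distribˡ-* 2 (q ^ (1 + 2 * u)) 3)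
                         (cong (λ x → (2 * x) % 3) (odd-power-% 1 q u q≡2 refl)))) (3∤val z∈)
      sum-even : ∀ ys → (∀ {z} → z ∈ ys → z ∈ zs) → ∃ λ u → sum (map proj₂ ys) ≡ 2 * u
      sum-even [] _ = 0 , refl
      sum-even (y ∷ ys) sub with u , eq ← b-even (sub (here refl)) | v , eq′ ← sum-even ys (sub ∘ there) =
        u + v , trans (cong₂ _+_ eq eq′) (sym (*-distribˡ-+ 2 u v))
      sum-b-even = sum-even zs (λ z∈ → z∈)

    q≢0mod3 : Odd g → q % 3 ≢ 0
    q≢0mod3 g-odd q≡0 with refl ← prime∣prime prime[3] R.q-prime (m%n≡0⇒n∣m q 3 q≡0) =
      contradiction (g-odd⇒q≡1mod4 R g-odd) λ ()

    g-odd-case : Odd g → ⊥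
    g-odd-case g-odd with q % 3 in eq | m%n<n q 3
    ... | 0 | _ = q≢0mod3 g-odd eq
    ... | 1 | _ = q≡1mod3-case g-odd eq
    ... | 2 | _ = q≡2mod3-case g-odd eq
    ... | suc (suc (suc _)) | s≤s (s≤s (s≤s ()))

  three∈ : Odd f ⊎ Odd g → Answer N
  three∈ o with odd? g | o
  ... | yes g-odd | _           = ⊥-elim (g-odd-case g-odd)
  ... | no g-even | inj₁ f-odd = g-even-case g-even f-odd
  ... | no g-even | inj₂ g-odd = contradiction g-odd g-even

-- The case without a component 3.

module _ {N q f g xs} (R : Remaining N q f g 1 1 0 0 xs) (no-3 : (2 , 0) ∉ xs) (2≤f : 2 ≤ f) where
  private
    module R = Remaining R

    both-even : ¬ Odd g → ¬ Odd f → ⊥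
    both-even g-even f-even = R.too-dense 2 2<q 2 2 2≤f (not-odd-≥ 0 g-even R.0<g)
      (mass-U₁ 1 (s≤s z≤n)) (cover-U₁ R 2 2<q g-even f-even) (<ᵇ⇒< _ _ tt)
      where
      2<q : 2 < q
      2<q with odd-prime-cases R.1<q R.q-odd
      ... | inj₁ refl = ≤-refl
      ... | inj₂ 5≤q  = ≤-trans (s≤s (s≤s (s≤s z≤n))) 5≤q
      open Size q f g 2 2<q

    -- 3 ∣ 2 ^ f + 1, but a component 2 ^ a * 3 ^ b - 1 with b > 0 is prime to 3.
    q≢3 : ¬ Odd g → Odd f → q ≢ 3
    q≢3 g-even (t , refl) refl with euclidsLemma 2 N prime[3] (subst (3 ∣_) (sym R.2N) (∣m⇒∣m*n (3 ^ g + 1) (odd-power+1 1 2 t refl refl)))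
    ... | inj₁ 3∣2 = contradiction (∣⇒≤ 3∣2) (<⇒≱ ≤-refl)
    ... | inj₂ 3∣N = ∤product (val 3) prime[3] xs 3∤val (subst (3 ∣_) (sym (trans (sym (*-identityˡ _)) R.N≡)) 3∣N)
      where
      3∤pred : ∀ a b → 3 ∤ 2 ^ a * 3 ^ suc b ∸ 1
      3∤pred a b 3∣ = prime∤1 prime[3] (∣m+n∣m⇒∣n (subst (3 ∣_) (sym (m∸n+n≡m (>-nonZero⁻¹ _ {{m*n≢0 (2 ^ a) (3 ^ suc b) {{m^n≢0 2 a}} {{m^n≢0 3 (suc b)}}}})))
        (∣n⇒∣m*n (2 ^ a) (m∣m*n (3 ^ b)))) 3∣)
      3∤val : ∀ {y} → y ∈ xs → 3 ∤ val 3 y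
      3∤val y∈ with All.lookup R.shapes y∈
      ... | one b        = 3∤pred 1 b
      ... | three _      = contradiction y∈ no-3
      ... | two _ t      = 3∤pred 2 (2 * t)
      ... | high o _ _ _ = contradiction o g-even

    f-odd,g-even : ¬ Odd g → Odd f → ⊥
    f-odd,g-even g-even f-odd with odd-prime-cases R.1<q R.q-odd
    ... | inj₁ q≡3 = q≢3 g-even f-odd q≡3
    ... | inj₂ 5≤q = R.too-dense 4 5≤q 3 2 (odd-≥ 1 f-odd 2≤f) (not-odd-≥ 0 g-even R.0<g)
      (mass-++ (mass-U₁ 1 (s≤s z≤n)) (mass-U₂ 1 (s≤s z≤n)))
      (cover-U₁₂ R 4 5≤q g-even no-3) (<ᵇ⇒< _ _ tt)
      where open Size q f g 4 5≤q

    g-odd-case : Odd g → ⊥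
    g-odd-case g-odd with 1mod4-cases R.1<q (g-odd⇒q≡1mod4 R g-odd)
    ... | inj₂ 9≤q = R.too-dense 8 9≤q 2 1 2≤f R.0<g
      (mass-++ (mass-++ (mass-U₁ 1 (s≤s z≤n)) (mass-U₂ 1 (s≤s z≤n))) mass-U₃)
      (cover-U₁₂₃ R 8 9≤q no-3) (<ᵇ⇒< _ _ tt)
      where open Size q f g 8 9≤q
    ... | inj₁ refl = q≡5-case g-odd
      where
      -- For g = 1 and f = 2 the value is already (5/4)(6/5)/2 = 3/4, and the mass bounds add more
      -- than 1/4; density is silent there, so g = 1 is treated by counting exponents.
      q≡5-case : Odd g → ⊥
      q≡5-case (zero , refl)  = ¬q≡5,g≡1 R 2≤f no-3
      q≡5-case (suc t , refl) = R.too-dense 4 ≤-refl 2 3 2≤f (s≤s (*-monoʳ-≤ 2 {1} {suc t} (s≤s z≤n)))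
        (mass-++ (mass-++ (mass-U₁ 1 (s≤s z≤n)) (mass-U₂ 1 (s≤s z≤n))) mass-U₃)
        (cover-U₁₂₃ R 4 ≤-refl no-3) (<ᵇ⇒< _ _ tt)
        where open Size 5 f g 4 ≤-refl

  three∉ : ⊥
  three∉ with odd? g | odd? f
  ... | yes g-odd | _         = g-odd-case g-odd
  ... | no g-even | yes f-odd = f-odd,g-even g-even f-odd
  ... | no g-even | no f-even = both-even g-even f-even

remaining⇒answer : ∀ {N q f g xs} → Remaining N q f g 1 1 0 0 xs → Answer N
remaining⇒answer {f = f} {xs = xs} R with (2 , 0) ∈? xs | f ≟ 1
... | yes 3∈ | _ with _ , R′ , no-3 , sub ← Remaining.remove R 3∈ with All.lookup (Remaining.shapes R) 3∈
...   | three o = three∈ R′ no-3 (proj₂ ∘ sub) o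
remaining⇒answer R | no no-3 | yes refl = inj₁ (f≡1⇒N≡9 R)
remaining⇒answer R | no no-3 | no f≢1 = ⊥-elim (three∉ R no-3 (≤∧≢⇒< (Remaining.0<f R) (f≢1 ∘ sym)))

theorem1p1 : (k : ℕ) → σ* (σ* (2 * k + 1)) ≡ 2 * (2 * k + 1) →
    (2 * k + 1 ≡ 9) ⊎ (2 * k + 1 ≡ 165)
theorem1p1 k perfect = remaining⇒answer (proj₂ (proj₂ (proj₂ (proj₂ (perfect⇒remaining odd-N perfect)))))
  where
  odd-N : (2 * k + 1) % 2 ≡ 1
  odd-N = trans (cong (_% 2) (trans (+-comm (2 * k) 1) (cong (1 +_) (*-comm 2 k)))) ([m+kn]%n≡m%n 1 k 2)
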